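{- Let $n\ge2$ and let $H=(h_1>\cdots>h_p=1)$ be a decreasing gap sequence. Let $J\subseteq\{2,\dots,p\}$ be a set of passes such that each $j\in J$ admits Apéry data with parameters $(L_j,B_j)$. Then $$C_n(H)\ \le\ n\Big(p+\sum_{j\in J}L_jB_j+\sum_{j\notin J}M_j\Big)-\frac12\sum_{j=1}^{p}h_j\,g_j^{(n)}\big(g_j^{(n)}+1\big)\ \le\ n\Big(p+\sum_{j\in J}L_jB_j+\sum_{j\notin J}M_j\Big),$$ where $j\notin J$ ranges over $\{1,\dots,p\}\setminus J$. In particular, for a family of gap sequences (one for each $n$), if $p+\sum_{j\in J}L_jB_j+\sum_{j\notin J}M_j$ is polylogarithmic in $n$, then the worst-case cost is at most a polylogarithmic factor above linear. More generally, $$W_n(H)\le n\,\mathfrak A_n(H),\qquad C_n(H)\le n\bigl(p+\mathfrak A_n(H)\bigr).$$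
   Context: Shellsort: a gap sequence is a decreasing sequence of positive integers $H=(h_1>h_2>\cdots>h_p=1)$. On an array of $n$ distinct keys (a permutation), pass $j$ runs ordinary insertion sort separately on each $h_j$-chain, i.e. on each set of positions with the same remainder modulo $h_j$: the key is repeatedly compared with the key $h_j$ positions before it, exchanging the two if they are out of order, until no exchange is needed or the start of the chain is reached. Passes are run for $j=1,2,\dots,p$. $W_n(H)$ and $C_n(H)$ are the worst-case (over all inputs of $n$ keys) total numbers of exchanges and of comparisons. $S_s=\{\sum_{i\le s}x_ih_i:x_i\in\mathbb N_0\}$ (so $S_0=\{0\}$), $Q_j=\{m\in\mathbb N_0: mh_j\in S_{j-1}\}$, $M_j=\lfloor(n-1)/h_j\rfloor$, $g_j^{(n)}=|\{1\le m\le M_j: m\notin Q_j\}|$, $U_s(n)=\sum_{1\le d<n,\ d\notin S_s}(n-d)$. Pass $j\ge2$ admits Apéry data with parameters $(L_j,B_j)$, $L_j,B_j\ge1$, if there is an integer $a\in Q_j$, $a\ge2$, such that $ah_j$ has a short representation, and for every residue $r\in\{0,\dots,a-1\}$ there is $w_r\in Q_j$ with $w_r\equiv r\pmod a$ such that $w_rh_j$ has a short representation (with $w_0=0$). Here a short representation of an integer $N$ is a vector $x\in\mathbb N_0^{j-1}$ with $\sum_{i<j}x_ih_i=N$, $\|x\|_1\le L_j$, and $h_i\le B_jh_j$ whenever $x_i>0$. $$\mathfrak A_n(H)=\min\Big[\sum_{j\in J}L_jB_j+\sum_{1\le j\le s,\ j\notin J}M_j+\frac{U_s(n)}n\Big],$$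 the minimum being over all $0\le s\le p$, all $J\subseteq\{1,\dots,s\}$ such that every $j\in J$ (necessarily $j\ge2$) admits Apéry data, and all admissible parameters $(L_j,B_j)$ for $j\in J$.
   Formalization: The Apéry parameters L_j and B_j, including those in the minimum defining 𝔄_n(H), range over rational numbers ≥ 1 instead of real numbers ≥ 1. -}

module Defs where

open import Data.Bool.Base using (if_then_else_)
open import Data.Fin.Base as Fin using (Fin; zero; suc; toℕ; fromℕ; fromℕ<; inject₁; inject!)
open import Data.Fin.Permutation.Components using (transpose)
open import Data.Fin.Subset using (Subset; _∈_; _⊆_; _─_; ∁)
import Data.Fin.Properties as Fin
import Data.Integer.Base as ℤ
open import Data.List.Base as List using (List; []; _∷_; applyUpTo; upTo; allFin; filter; length; foldl; cartesianProductWith)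
open import Data.List.Extrema.Nat using (max)
open import Data.Nat.Base
open import Data.Nat.Divisibility using (_∣_)
open import Data.Nat.ListAction using () renaming (sum to sumList)
open import Data.Nat.Logarithm using (⌊log₂_⌋)
open import Data.Nat.Properties
open import Data.Product using (∃-syntax; Σ-syntax; _×_; _,_)
open import Data.Rational.Base as ℚ using (ℚ; 0ℚ; 1ℚ)
import Data.Rational.Properties as ℚ
open import Data.Vec.Base as Vec using (Vec; []; _∷_; lookup; tabulate)
open import Data.Vec.Functional as Vector using (Vector)
open import Data.Vec.Relation.Unary.AllPairs using (allPairs?)
open import Data.Vec.Relation.Unary.Unique.Propositional using (Unique)
open import Function.Base using (_∘_)
open import Relation.Binary.PropositionalEquality.Core using (_≡_; refl; sym; trans; cong)
open import Relation.Nullary using (does; yes; no; ¬?; _×-dec_)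
open import Relation.Nullary.Decidable using (map′)
open import Relation.Unary using (Decidable)

open import Algebra.Properties.Semiring.Sum +-*-semiring public using (sum)
open import Algebra.Properties.CommutativeMonoid.Sum ℚ.+-0-commutativeMonoid public using () renaming (sum to sumℚ)

-- Pass j ∈ {1,…,p} of the mathematics is the index of type Fin passes whose
-- toℕ is j - 1; a number 0 ≤ s ≤ p of passes is an element of Fin (suc passes).

record GapSequence : Set where
  field
    passes-1   : ℕ

  passes : ℕ
  passes = suc passes-1

  field
    gap        : Fin passes → ℕ
    positive   : ∀ j → 0 < gap j
    decreasing : ∀ {i j} → i Fin.< j → gap j < gap i
    last≡1     : gap (fromℕ passes-1) ≡ 1

open GapSequence public

-- Keys are the elements of Fin n in their usual order.

record State (n : ℕ) : Set where
  constructor state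
  field
    array       : Fin n → Fin n
    exchanges   : ℕ
    comparisons : ℕ

open State public

-- The q-th element (from 0) of the h-chain of residue r is at position r + q * h.
-- The key there is moved down the chain until it is in order with its
-- predecessor or reaches the start of the chain.

insert : ∀ {n} (h r q : ℕ) → r + q * h < n → State n → State n
insert h r zero    _  σ = σ
insert {n} h r (suc q) lt (state a e c) =
  if does (a here Fin.<? a before)
  then insert h r q lt′ (state (a ∘ transpose here before) (suc e) (suc c))
  else state a e (suc c)
  where
  lt′ : r + q * h < n
  lt′ = ≤-<-trans (+-monoʳ-≤ r (m≤n+m (q * h) h)) lt

  here before : Fin n
  here   = fromℕ< lt
  before = fromℕ< lt′

-- Insertion sort of the first k elements of a chain (of the whole chain, if it
-- has at most k elements).

sortChain : ∀ {n} (h r k : ℕ) → State n → State n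
sortChain     h r zero    σ = σ
sortChain {n} h r (suc k) σ with r + k * h <? n
... | yes lt = insert h r k lt (sortChain h r k σ)
... | no  _  = sortChain h r k σ

-- For h ≥ 1 a chain has at most n elements.

pass : ∀ {n} → ℕ → State n → State n
pass {n} h σ = foldl (λ τ r → sortChain h r n τ) σ (upTo h)

shellsort : ∀ {n} → GapSequence → (Fin n → Fin n) → State n
shellsort H a = foldl (λ σ j → pass (gap H j) σ) (state a 0 0) (allFin (passes H))

vectors : ∀ {A : Set} → List A → (k : ℕ) → List (Vec A k)
vectors xs zero    = [] ∷ []
vectors xs (suc k) = cartesianProductWith _∷_ xs (vectors xs k)

unique? : ∀ {n k} → Decidable (Unique {A = Fin n} {n = k})
unique? = allPairs? (λ x y → ¬? (x Fin.≟ y))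

inputs : (n : ℕ) → List (Vec (Fin n) n)
inputs n = filter unique? (vectors (allFin n) n)

worstCase : (n : ℕ) → GapSequence → (State n → ℕ) → ℕ
worstCase n H cost = max 0 (List.map (λ v → cost (shellsort H (lookup v))) (inputs n))

W C : ℕ → GapSequence → ℕ
W n H = worstCase n H exchanges
C n H = worstCase n H comparisons

combination : ∀ {k} → Vector ℕ k → Vector ℕ k → ℕ
combination h x = sum (λ i → x i * h i)

Representable : ∀ {k} → Vector ℕ k → ℕ → Set
Representable {k} h m = Σ[ x ∈ Vector ℕ k ] combination h x ≡ m

initialGaps : (H : GapSequence) (s : Fin (suc (passes H))) → Vector ℕ (toℕ s)
initialGaps H s i = gap H (inject! i)

S : (H : GapSequence) → Fin (suc (passes H)) → ℕ → Set
S H s = Representable (initialGaps H s)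

-- With the shift of indices, inject₁ j stands for the number j - 1 of passes
-- preceding pass j.

Q : (H : GapSequence) → Fin (passes H) → ℕ → Set
Q H j m = S H (inject₁ j) (m * gap H j)

representable? : ∀ {k} (h : Vector ℕ k) → (∀ i → 0 < h i) → Decidable (Representable h)
representable? {zero}  h h>0 m = map′ (λ eq → (λ ()) , eq) (λ (_ , eq) → eq) (0 ≟ m)
representable? {suc k} h h>0 m = map′ to from (anyUpTo? coefficient? (suc m))
  where
  h₀ = h zero

  P : ℕ → Set
  P c = c * h₀ ≤ m × Representable (h ∘ suc) (m ∸ c * h₀)

  coefficient? : Decidable P
  coefficient? c = c * h₀ ≤? m ×-dec representable? (h ∘ suc) (h>0 ∘ suc) (m ∸ c * h₀)

  to : (∃[ c ] c < suc m × P c) → Representable h m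
  to (c , _ , le , x , eq) =
    (c Vector.∷ x) , trans (cong ((c * h₀) +_) eq) (m+[n∸m]≡n le)

  from : Representable h m → ∃[ c ] c < suc m × P c
  from (x , refl) = x zero
    , s≤s (≤-trans (m≤m*n (x zero) h₀ {{>-nonZero (h>0 zero)}}) (m≤m+n _ _))
    , m≤m+n _ _
    , x ∘ suc , sym (m+n∸m≡n (x zero * h₀) _)

S? : ∀ H s → Decidable (S H s)
S? H s = representable? (initialGaps H s) (λ i → positive H (inject! i))

Q? : ∀ H j → Decidable (Q H j)
Q? H j m = S? H (inject₁ j) (m * gap H j)

1⋯_ : ℕ → List ℕ
1⋯ k = applyUpTo suc k

M : ℕ → (H : GapSequence) → Fin (passes H) → ℕ
M n H j = (n ∸ 1) / gap H j
  where instance _ = >-nonZero (positive H j)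

g : ℕ → (H : GapSequence) → Fin (passes H) → ℕ
g n H j = length (filter (¬? ∘ Q? H j) (1⋯ M n H j))

U : ℕ → (H : GapSequence) → Fin (suc (passes H)) → ℕ
U n H s = sumList (List.map (n ∸_) (filter (¬? ∘ S? H s) (1⋯ (n ∸ 1))))

fromℕℚ : ℕ → ℚ
fromℕℚ k = ℤ.+ k ℚ./ 1

record ShortRepresentation (H : GapSequence) (j : Fin (passes H)) (L B : ℚ) (N : ℕ) : Set where
  field
    x           : Vector ℕ (toℕ (inject₁ j))
    represents  : combination (initialGaps H (inject₁ j)) x ≡ N
    norm≤L      : fromℕℚ (sum x) ℚ.≤ L
    gaps≤B*gap  : ∀ i → 0 < x i → fromℕℚ (initialGaps H (inject₁ j) i) ℚ.≤ B ℚ.* fromℕℚ (gap H j)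

-- The parameters L and B are not required to be integers.  Nor is j ≥ 2 imposed:
-- for the first pass the vector x is empty, and the positive integer a * gap H j
-- has no representation.

record AperyData (H : GapSequence) (j : Fin (passes H)) (L B : ℚ) : Set where
  field
    L≥1     : 1ℚ ℚ.≤ L
    B≥1     : 1ℚ ℚ.≤ B
    a       : ℕ
    a≥2     : 2 ≤ a
    a∈Q     : Q H j a
    a-short : ShortRepresentation H j L B (a * gap H j)
    w       : ℕ → ℕ
    w₀≡0    : w 0 ≡ 0
    w∈Q     : ∀ r → r < a → Q H j (w r)
    w≡r     : ∀ r → r < a → a ∣ ∣ w r - r ∣
    w-short : ∀ r → r < a → ShortRepresentation H j L B (w r * gap H j)

∑∈ : ∀ {p} → Subset p → (Fin p → ℚ) → ℚ
∑∈ J f = sumℚ (λ j → if lookup J j then f j else 0ℚ)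

firstPasses : ∀ {p} → Fin (suc p) → Subset p
firstPasses s = tabulate (λ j → toℕ j <ᵇ toℕ s)

-- 𝔄ₙ(H) is the minimum of value n H over Choice H.  Only the values of L and B on
-- J matter.

record Choice (H : GapSequence) : Set where
  field
    s     : Fin (suc (passes H))
    J     : Subset (passes H)
    J⊆s   : J ⊆ firstPasses s
    L B   : Fin (passes H) → ℚ
    apery : ∀ {j} → j ∈ J → AperyData H j (L j) (B j)

-- NonTrivial n says n ≥ 2.

value : (n : ℕ) .{{_ : NonTrivial n}} (H : GapSequence) → Choice H → ℚ
value n H c =
  ∑∈ J (λ j → L j ℚ.* B j)
  ℚ.+ ∑∈ (firstPasses s ─ J) (λ j → fromℕℚ (M n H j))
  ℚ.+ (ℤ.+ U n H s) ℚ./ n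
  where
  open Choice c
  instance _ = nonTrivial⇒nonZero n

Is𝔄 : (n : ℕ) .{{_ : NonTrivial n}} → GapSequence → ℚ → Set
Is𝔄 n H α = (∃[ c ] value n H c ≡ α) × (∀ c → α ℚ.≤ value n H c)

overhead : ℕ → (H : GapSequence) → Subset (passes H) → (L B : Fin (passes H) → ℚ) → ℚ
overhead n H J L B =
  fromℕℚ (passes H) ℚ.+ ∑∈ J (λ j → L j ℚ.* B j) ℚ.+ ∑∈ (∁ J) (λ j → fromℕℚ (M n H j))

-- The rounding of the logarithm is absorbed by the constant c.

Polylogarithmic : (ℕ → ℚ) → Set
Polylogarithmic f = ∃[ c ] ∃[ k ] ∃[ N ] (∀ n → N ≤ n → f n ℚ.≤ fromℕℚ (c * ⌊log₂ n ⌋ ^ k))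

QuasiLinear : (ℕ → ℕ) → Set
QuasiLinear cost =
  ∃[ f ] Polylogarithmic f × (∀ n → 2 ≤ n → fromℕℚ (cost n) ℚ.≤ fromℕℚ n ℚ.* f n)

{-# OPTIONS --safe #-}
-- Insertion sort of an h-chain exchanges exactly along inversions, so a pass costs at
-- most the number of out-of-order pairs at distances m h.  After the passes before j the
-- array is ordered at every distance in S (a later pass keeps it so), hence only m ∉ Q
-- contribute: at most Σ (n - m h) ≤ n g - h g (g + 1) / 2 over the g such m.  With Apéry
-- data every m ∉ Q is below the representative w of its residue class, and w ≤ L B, so
-- g ≤ L B.  All passes after s together exchange at most the inversions left after pass s,
-- which number at most U.  The minimum 𝔄 is attained because L may be rounded down to an
-- integer and B to a ratio of gaps, and data with L B > M are never useful.

module Submission where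

open import Defs
open import Data.Bool.Base using (Bool; if_then_else_; true; false; _∧_; not)
open import Data.Bool.Properties using (∧-zeroʳ; ∧-identityʳ)
open import Data.Empty using (⊥)
open import Data.Fin.Base as Fin using (Fin; zero; suc; toℕ; fromℕ; fromℕ<; inject₁; inject!; punchIn; punchOut)
open import Data.Fin.Permutation as Perm using (Permutation′; _⟨$⟩ʳ_; _⟨$⟩ˡ_; _∘ₚ_; inverseʳ; inverseˡ)
open import Data.Fin.Permutation.Components using (transpose)
import Data.Fin.Properties as Fin
open import Data.Fin.Subset using (Subset; _∈_; _∉_; _─_; ∁)
import Data.Integer.Base as ℤ
import Data.Integer.Properties as ℤ
open import Data.List.Base as List using (List; []; _∷_; _++_; foldl; filter; length; upTo)
open import Data.List.Extrema.Nat using (max≤v⁺)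
open import Data.List.Membership.Propositional using () renaming (_∈_ to _∈ˡ_)
open import Data.List.Membership.Propositional.Properties using (∈-map⁺; ∈-filter⁺; ∈-applyUpTo⁺)
open import Data.List.Properties
  using (++-identityʳ; applyUpTo-∷ʳ; filter-++; foldl-∷ʳ; length-++; length-applyUpTo; length-filter; upTo-∷ʳ)
import Data.List.Relation.Unary.All as All
import Data.List.Relation.Unary.All.Properties as All
open import Data.List.Relation.Unary.Any using (here; there)
open import Data.Maybe.Base using (Maybe; just; nothing; is-just)
open import Data.Nat.Base
open import Data.Nat.DivMod
open import Data.Nat.Divisibility using (_∣_; _∣?_; divides)
open import Data.Nat.ListAction using () renaming (sum to sumList)
open import Data.Nat.Properties
open import Data.Nat.Tactic.RingSolver using (solve-∀)
open import Data.Product using (Σ-syntax; ∃-syntax; _×_; _,_; proj₁; proj₂)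
open import Data.Rational.Base as ℚ using (ℚ; 0ℚ; 1ℚ; ½; toℚᵘ)
import Data.Rational.Properties as ℚ
open import Data.Rational.Unnormalised.Base as ℚᵘ using (mkℚᵘ; *≡*; *≤*)
import Data.Rational.Unnormalised.Properties as ℚᵘ
open import Data.Sum using (_⊎_; inj₁; inj₂; [_,_]′)
open import Data.Unit.Base using (⊤; tt)
open import Data.Vec.Base as Vec using (lookup)
open import Data.Vec.Functional as Vector using (Vector; removeAt)
open import Data.Vec.Properties using ([]=⇒lookup; lookup⇒[]=; lookup-map; lookup-zipWith; lookup∘tabulate)
open import Function.Base using (_∘_; id)
open import Level using (0ℓ)
open import Relation.Binary.Core using (Rel)
open import Relation.Binary.Definitions using (Transitive; Irreflexive) renaming (Decidable to Decidable₂)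
open import Relation.Binary.PropositionalEquality hiding (J)
open import Relation.Nullary using (Dec; does; yes; no; ¬_; ¬?; contradiction)
open import Relation.Nullary.Decidable using (dec-true; dec-false; map′; _×-dec_; _→-dec_)
open import Relation.Unary using (Decidable)
open import Algebra.Properties.CommutativeMonoid.Sum ℚ.+-0-commutativeMonoid using ()
  renaming (∑-distrib-+ to sumℚ-+; sum-cong-≗ to sumℚ-cong)
open import Algebra.Properties.Semiring.Sum +-*-semiring
  using (sum-remove; sum-cong-≗; ∑-distrib-+; ∑-comm; sum-replicate-zero; *-distribˡ-sum)

-- Inversions along a strict partial order

-- The step that needs a separate argument is that a pass with gap `h` preserves order at a distance
-- `k`. This order may break in the middle of the pass, when some chains are sorted and others are
-- not, so it cannot be an invariant of the single exchanges. The proof uses only two facts about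
-- the finished pass: the result is ordered at distance `h`, and each key has stayed in its residue
-- class. A pigeonhole argument does the rest. Costs are handled by a potential. For any strict
-- partial order of the positions that contains the pairs at distance `h`, the sum of exchanges done
-- and inversions left never grows. The chain order gives the bound for a single pass, the full
-- order of positions the bound for all passes after `s`. An insertion makes at most one comparison
-- that is not followed by an exchange, and a pass makes at most `n` insertions; this is the origin
-- of the summand `n p`. The saving `h g (g + 1) / 2` comes from the fact that the i-th smallest of
-- the `g` multipliers outside `Q` is at least i. For fixed `s` the value of a choice is a sum of
-- independent costs of passes, so its minimisation splits into one problem per pass.

sum-mono : ∀ {n} {f g : Vector ℕ n} → (∀ i → f i ≤ g i) → sum f ≤ sum g
sum-mono {zero}  f≤g = z≤n
sum-mono {suc n} f≤g = +-mono-≤ (f≤g zero) (sum-mono (f≤g ∘ suc))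

term≤sum : ∀ {n} (f : Vector ℕ n) i → f i ≤ sum f
term≤sum f zero    = m≤m+n _ _
term≤sum f (suc i) = ≤-trans (term≤sum (f ∘ suc) i) (m≤n+m _ _)

sum-split₂ : ∀ {n} (f : Vector ℕ (2 + n)) {i j} (i≢j : i ≢ j) →
  sum f ≡ f i + f j + sum (λ l → f (punchIn i (punchIn (punchOut i≢j) l)))
sum-split₂ f {i} {j} i≢j = begin
  sum f                                         ≡⟨ sum-remove {i = i} f ⟩
  f i + sum (removeAt f i)                      ≡⟨ cong (f i +_) (sum-remove {i = punchOut i≢j} (removeAt f i)) ⟩
  f i + (f (punchIn i (punchOut i≢j)) + rest)   ≡⟨ cong (λ k → f i + (f k + rest)) (Fin.punchIn-punchOut i≢j) ⟩
  f i + (f j + rest)                            ≡⟨ +-assoc (f i) (f j) rest ⟨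
  f i + f j + rest                              ∎
  where
  open ≡-Reasoning
  rest = sum (λ l → f (punchIn i (punchIn (punchOut i≢j) l)))

-- An exchange of keys changes two positions only. There the terms cannot be compared one by one,
-- merely their sum, which is also where the gain `d` arises.
sum-mono₂ : ∀ {n} (f g : Vector ℕ n) {i j} d → i ≢ j →
  (∀ x → x ≢ i → x ≢ j → f x ≤ g x) → f i + f j + d ≤ g i + g j → sum f + d ≤ sum g
sum-mono₂ {suc zero}    f g {zero} {zero} d i≢j _ _ = contradiction refl i≢j
sum-mono₂ {suc (suc n)} f g {i} {j} d i≢j off at = begin
  sum f + d                      ≡⟨ cong (_+ d) (sum-split₂ f i≢j) ⟩
  f i + f j + rest f + d         ≡⟨ shuffle (f i + f j) (rest f) d ⟩
  f i + f j + d + rest f         ≤⟨ +-mono-≤ at (sum-mono (λ l → off _ (≢i l) (≢j l))) ⟩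
  g i + g j + rest g             ≡⟨ sum-split₂ g i≢j ⟨
  sum g                          ∎
  where
  open ≤-Reasoning
  other : Fin n → Fin (2 + n)
  other l = punchIn i (punchIn (punchOut i≢j) l)
  rest : Vector ℕ (2 + n) → ℕ
  rest h = sum (h ∘ other)
  shuffle : ∀ a b c → a + b + c ≡ a + c + b
  shuffle = solve-∀
  ≢i : ∀ l → other l ≢ i
  ≢i l = Fin.punchInᵢ≢i i _
  ≢j : ∀ l → other l ≢ j
  ≢j l eq = Fin.punchInᵢ≢i (punchOut i≢j) l
    (Fin.punchIn-injective i _ _ (trans eq (sym (Fin.punchIn-punchOut i≢j))))

-- Only `does` is inspected, so the indicators of `suc m ≟ suc n` and `m ≟ n`, and likewise for
-- `<?`, agree definitionally. This carries the induction in `sum-point`.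
𝟙 : ∀ {P : Set} → Dec P → ℕ
𝟙 P? = if does P? then 1 else 0

𝟙-yes : ∀ {P : Set} (P? : Dec P) → P → 𝟙 P? ≡ 1
𝟙-yes P? p = cong (if_then 1 else 0) (dec-true P? p)

𝟙-no : ∀ {P : Set} (P? : Dec P) → ¬ P → 𝟙 P? ≡ 0
𝟙-no P? ¬p = cong (if_then 1 else 0) (dec-false P? ¬p)

𝟙-mono : ∀ {P Q : Set} (P? : Dec P) (Q? : Dec Q) → (P → Q) → 𝟙 P? ≤ 𝟙 Q?
𝟙-mono P? Q? f with P?
... | no  _ = z≤n
... | yes p = ≤-reflexive (sym (𝟙-yes Q? (f p)))

rearrangement : ∀ {p q u v} → p ≤ q → u ≤ v → p * v + q * u ≤ p * u + q * v
rearrangement {p} {u = u} p≤q u≤v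
  with k , refl ← m≤n⇒∃[o]m+o≡n p≤q | l , refl ← m≤n⇒∃[o]m+o≡n u≤v =
  ≤-trans (m≤m+n _ (k * l)) (≤-reflexive (identity p k u l))
  where
  identity : ∀ p k u l → p * (u + l) + (p + k) * u + k * l ≡ p * u + (p + k) * (u + l)
  identity = solve-∀

transpose-fst : ∀ {n} (i j : Fin n) → transpose i j i ≡ j
transpose-fst i j rewrite dec-true (i Fin.≟ i) refl = refl

transpose-snd : ∀ {n} (i j : Fin n) → transpose i j j ≡ i
transpose-snd i j with j Fin.≟ i
... | yes j≡i = j≡i
... | no _ rewrite dec-true (j Fin.≟ j) refl = refl

transpose-other : ∀ {n} (i j : Fin n) {k} → k ≢ i → k ≢ j → transpose i j k ≡ k
transpose-other i j {k} k≢i k≢j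
  rewrite dec-false (k Fin.≟ i) k≢i | dec-false (k Fin.≟ j) k≢j = refl

module Inversions {n : ℕ} {R : Rel (Fin n) 0ℓ} (R? : Decidable₂ R) where

  -- A product of two indicators, because each factor is monotone in its own argument and the
  -- product has the shape that `rearrangement` expects.
  inverted : (Fin n → Fin n) → Fin n → Fin n → ℕ
  inverted a x y = 𝟙 (R? x y) * 𝟙 (a y Fin.<? a x)

  inversions : (Fin n → Fin n) → ℕ
  inversions a = sum (λ x → sum (inverted a x))

  module _ (R-irrefl : Irreflexive _≡_ R) (R-trans : Transitive R) where

    -- The two pairs joining a third position to the exchanged ones are compared by
    -- the rearrangement inequality.
    exchange-inversions : ∀ (a : Fin n → Fin n) {i j} → R i j → a j Fin.< a i →
      suc (inversions (a ∘ transpose j i)) ≤ inversions a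
    exchange-inversions a {i} {j} iRj aj<ai = begin
      suc (inversions b)    ≡⟨ +-comm 1 (inversions b) ⟩
      inversions b + 1      ≤⟨ sum-mono₂ _ _ 1 i≢j row rows ⟩
      inversions a          ∎
      where
      open ≤-Reasoning
      b = a ∘ transpose j i

      i≢j : i ≢ j
      i≢j i≡j = R-irrefl i≡j iRj

      b-i : b i ≡ a j
      b-i = cong a (transpose-snd j i)

      b-j : b j ≡ a i
      b-j = cong a (transpose-fst j i)

      b-other : ∀ {x} → x ≢ i → x ≢ j → b x ≡ a x
      b-other x≢i x≢j = cong a (transpose-other j i x≢j x≢i)

      row : ∀ x → x ≢ i → x ≢ j → sum (inverted b x) ≤ sum (inverted a x)
      row x x≢i x≢j = subst (_≤ _) (+-identityʳ _)
        (sum-mono₂ (inverted b x) (inverted a x) 0 i≢j same pair)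
        where
        same : ∀ y → y ≢ i → y ≢ j → inverted b x y ≤ inverted a x y
        same y y≢i y≢j rewrite b-other x≢i x≢j | b-other y≢i y≢j = ≤-refl

        pair : inverted b x i + inverted b x j + 0 ≤ inverted a x i + inverted a x j
        pair rewrite b-other x≢i x≢j | b-i | b-j
          | +-identityʳ (𝟙 (R? x i) * 𝟙 (a j Fin.<? a x) + 𝟙 (R? x j) * 𝟙 (a i Fin.<? a x)) =
          rearrangement (𝟙-mono (R? x i) (R? x j) (λ xRi → R-trans xRi iRj))
                        (𝟙-mono (a i Fin.<? a x) (a j Fin.<? a x) (<-trans aj<ai))

      rows-at : ∀ y → y ≢ i → y ≢ j →
        inverted b i y + inverted b j y ≤ inverted a i y + inverted a j y
      rows-at y y≢i y≢j rewrite b-other y≢i y≢j | b-i | b-j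
        | +-comm (𝟙 (R? i y) * 𝟙 (a y Fin.<? a j)) (𝟙 (R? j y) * 𝟙 (a y Fin.<? a i))
        | +-comm (𝟙 (R? i y) * 𝟙 (a y Fin.<? a i)) (𝟙 (R? j y) * 𝟙 (a y Fin.<? a j)) =
        rearrangement (𝟙-mono (R? j y) (R? i y) (R-trans iRj))
                      (𝟙-mono (a y Fin.<? a j) (a y Fin.<? a i) (λ y<j → <-trans y<j aj<ai))

      b-diagonal : ∀ {x y} → b y ≡ b x → inverted b x y ≡ 0
      b-diagonal {x} {y} eq =
        trans (cong (𝟙 (R? x y) *_) (𝟙-no (b y Fin.<? b x) (<-irrefl (cong toℕ eq))))
              (*-zeroʳ (𝟙 (R? x y)))

      b-ij : inverted b i j ≡ 0
      b-ij = trans (cong (𝟙 (R? i j) *_) (𝟙-no (b j Fin.<? b i) ¬bj<bi)) (*-zeroʳ (𝟙 (R? i j)))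
        where
        ¬bj<bi : ¬ (b j Fin.< b i)
        ¬bj<bi rewrite b-i | b-j = <-asym aj<ai

      b-ji : inverted b j i ≡ 0
      b-ji = cong (_* 𝟙 (b i Fin.<? b j))
        (𝟙-no (R? j i) (λ jRi → R-irrefl refl (R-trans iRj jRi)))

      a-ij : inverted a i j ≡ 1
      a-ij = cong₂ _*_ (𝟙-yes (R? i j) iRj) (𝟙-yes (a j Fin.<? a i) aj<ai)

      -- The strict decrease comes from here: the pair of the two exchanged positions was inverted
      -- and no longer is.
      corner : (inverted b i i + inverted b j i) + (inverted b i j + inverted b j j) + 1
             ≤ (inverted a i i + inverted a j i) + (inverted a i j + inverted a j j)
      corner rewrite b-diagonal {i} {i} refl | b-diagonal {j} {j} refl | b-ij | b-ji | a-ij =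
        ≤-trans (s≤s z≤n) (m≤n+m _ (inverted a i i + inverted a j i))

      -- Row `j` alone may gain inversions, since position `j` receives the larger key; so the rows
      -- `i` and `j` are added and compared column by column.
      rows : sum (inverted b i) + sum (inverted b j) + 1
           ≤ sum (inverted a i) + sum (inverted a j)
      rows = begin
        sum (inverted b i) + sum (inverted b j) + 1
          ≡⟨ cong (_+ 1) (∑-distrib-+ (inverted b i) (inverted b j)) ⟨
        sum (λ y → inverted b i y + inverted b j y) + 1
          ≤⟨ sum-mono₂ _ (λ y → inverted a i y + inverted a j y) 1 i≢j rows-at corner ⟩
        sum (λ y → inverted a i y + inverted a j y)
          ≡⟨ ∑-distrib-+ (inverted a i) (inverted a j) ⟩
        sum (inverted a i) + sum (inverted a j)      ∎

-- Cost of insertion sort on the chains of a pass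

sum-zero : ∀ n → sum {n} (λ _ → 0) ≡ 0
sum-zero = sum-replicate-zero

sum-snoc : ∀ (f : ℕ → ℕ) k → sum {suc k} (f ∘ toℕ) ≡ sum {k} (f ∘ toℕ) + f k
sum-snoc f zero    = +-comm (f 0) 0
sum-snoc f (suc k) = trans (cong (f 0 +_) (sum-snoc (f ∘ suc) k)) (sym (+-assoc (f 0) _ _))

-- The summand `n ∸ (h + c)` is what the positions beyond this block of `h` leave over; it makes
-- consecutive blocks telescope in `sum-chains`.
sum-indicator : ∀ h c n → sum {h} (λ x → 𝟙 (toℕ x + c <? n)) + (n ∸ (h + c)) ≤ n ∸ c
sum-indicator zero    c n = ≤-refl
sum-indicator (suc h) c n = begin
  𝟙 (c <? n) + sum {h} (λ x → 𝟙 (suc (toℕ x + c) <? n)) + (n ∸ suc (h + c))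
    ≡⟨ +-assoc (𝟙 (c <? n)) _ _ ⟩
  𝟙 (c <? n) + (sum {h} (λ x → 𝟙 (suc (toℕ x + c) <? n)) + (n ∸ suc (h + c)))
    ≡⟨ cong (𝟙 (c <? n) +_) (cong₂ _+_ (sum-cong-≗ {h} λ x → cong (λ k → 𝟙 (k <? n)) (sym (+-suc (toℕ x) c)))
                                       (cong (n ∸_) (sym (+-suc h c)))) ⟩
  𝟙 (c <? n) + (sum {h} (λ x → 𝟙 (toℕ x + suc c <? n)) + (n ∸ (h + suc c)))
    ≤⟨ +-monoʳ-≤ (𝟙 (c <? n)) (sum-indicator h (suc c) n) ⟩
  𝟙 (c <? n) + (n ∸ suc c)
    ≤⟨ first ⟩
  n ∸ c ∎
  where
  open ≤-Reasoning
  first : 𝟙 (c <? n) + (n ∸ suc c) ≤ n ∸ c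
  first with c <? n
  ... | yes c<n rewrite 𝟙-yes (c <? n) c<n = ≤-reflexive (sym (+-∸-assoc 1 c<n))
  ... | no  c≮n rewrite 𝟙-no (c <? n) c≮n  = ∸-monoʳ-≤ n (n≤1+n c)

-- The positions r + q * h with r < h are pairwise distinct.
sum-chains : ∀ k h c n → sum {k} (λ q → sum {h} (λ r → 𝟙 (toℕ r + (toℕ q * h + c) <? n))) ≤ n ∸ c
sum-chains zero    h c n = z≤n
sum-chains (suc k) h c n = begin
  sum {h} (λ r → 𝟙 (toℕ r + c <? n)) + sum {k} (λ q → sum {h} (λ r → 𝟙 (toℕ r + (h + toℕ q * h + c) <? n)))
    ≡⟨ cong (sum {h} (λ r → 𝟙 (toℕ r + c <? n)) +_) (sum-cong-≗ {k} λ q → sum-cong-≗ {h} λ r →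
         cong (λ m → 𝟙 (toℕ r + m <? n)) (shift h (toℕ q * h) c)) ⟩
  sum {h} (λ r → 𝟙 (toℕ r + c <? n)) + sum {k} (λ q → sum {h} (λ r → 𝟙 (toℕ r + (toℕ q * h + (h + c)) <? n)))
    ≤⟨ +-monoʳ-≤ _ (sum-chains k h (h + c) n) ⟩
  sum {h} (λ r → 𝟙 (toℕ r + c <? n)) + (n ∸ (h + c))
    ≤⟨ sum-indicator h c n ⟩
  n ∸ c ∎
  where
  open ≤-Reasoning
  shift : ∀ h q c → h + q + c ≡ q + (h + c)
  shift = solve-∀

sum-point : ∀ n c → sum {n} (λ y → 𝟙 (toℕ y ≟ c)) ≤ 𝟙 (c <? n)
sum-point zero    c       = z≤n
sum-point (suc n) zero    = s≤s (≤-reflexive (sum-zero n))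
sum-point (suc n) (suc c) = sum-point n c

module _ {n : ℕ} where

  pairsAt : List ℕ → Fin n → Fin n → ℕ
  pairsAt D x y = sumList (List.map (λ d → 𝟙 (toℕ y ≟ toℕ x + d)) D)

  sum-pairsAt : ∀ D → sum (λ x → sum (pairsAt D x)) ≤ sumList (List.map (n ∸_) D)
  sum-pairsAt []      = ≤-reflexive (trans (sum-cong-≗ {n} (λ _ → sum-zero n)) (sum-zero n))
  sum-pairsAt (d ∷ D) = begin
    sum (λ x → sum (λ y → point x y + pairsAt D x y))
      ≡⟨ sum-cong-≗ {n} (λ x → ∑-distrib-+ (point x) (pairsAt D x)) ⟩
    sum (λ x → sum (point x) + sum (pairsAt D x))
      ≡⟨ ∑-distrib-+ (sum ∘ point) (λ x → sum (pairsAt D x)) ⟩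
    sum (λ x → sum (point x)) + sum (λ x → sum (pairsAt D x))
      ≤⟨ +-mono-≤ (sum-mono {n} (λ x → sum-point n (toℕ x + d))) (sum-pairsAt D) ⟩
    sum {n} (λ x → 𝟙 (toℕ x + d <? n)) + sumList (List.map (n ∸_) D)
      ≤⟨ +-monoˡ-≤ _ (≤-trans (m≤m+n _ _) (sum-indicator n d n)) ⟩
    (n ∸ d) + sumList (List.map (n ∸_) D) ∎
    where
    open ≤-Reasoning
    point : Fin n → Fin n → ℕ
    point x y = 𝟙 (toℕ y ≟ toℕ x + d)

  1≤pairsAt : ∀ {D d} {x y : Fin n} → d ∈ˡ D → toℕ y ≡ toℕ x + d → 1 ≤ pairsAt D x y
  1≤pairsAt {x = x} {y} (here refl) eq = ≤-trans (≤-reflexive (sym (𝟙-yes (toℕ y ≟ toℕ x + _) eq))) (m≤m+n _ _)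
  1≤pairsAt (there d∈D) eq = ≤-trans (1≤pairsAt d∈D eq) (m≤n+m _ _)

  -- Each inverted pair is counted at its own distance, and at most `n ∸ d` pairs of positions lie
  -- at distance `d`.
  inversions-≤ : ∀ {R : Rel (Fin n) 0ℓ} (R? : Decidable₂ R) (a : Fin n → Fin n) (D : List ℕ) →
    (∀ {x y} → R x y → a y Fin.< a x → ∃[ d ] d ∈ˡ D × toℕ y ≡ toℕ x + d) →
    Inversions.inversions R? a ≤ sumList (List.map (n ∸_) D)
  inversions-≤ R? a D covered =
    ≤-trans (sum-mono (λ x → sum-mono (counted x))) (sum-pairsAt D)
    where
    counted : ∀ x y → Inversions.inverted R? a x y ≤ pairsAt D x y
    counted x y with R? x y
    ... | no  _ = z≤n
    ... | yes xRy with a y Fin.<? a x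
    ...   | no  ay≮ax rewrite 𝟙-no (a y Fin.<? a x) ay≮ax = z≤n
    ...   | yes ay<ax rewrite 𝟙-yes (a y Fin.<? a x) ay<ax
            with d , d∈D , eq ← covered xRy ay<ax = 1≤pairsAt {x = x} {y} d∈D eq

-- Induction principles for the loops, and the two cost measures

foldl-upTo-ind : ∀ {A : Set} (P : ℕ → A → Set) (f : A → ℕ → A) {σ} k → P 0 σ →
  (∀ {i τ} → i < k → P i τ → P (suc i) (f τ i)) → P k (foldl f σ (upTo k))
foldl-upTo-ind P f zero    base step = base
foldl-upTo-ind P f {σ} (suc k) base step =
  subst (P (suc k)) (trans (sym (foldl-∷ʳ f σ k (upTo k))) (cong (foldl f σ) (upTo-∷ʳ k)))
    (step ≤-refl (foldl-upTo-ind P f k base (λ i<k → step (m<n⇒m<1+n i<k))))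

-- The predicate relates the input state to the output state. Cost, inversions, sortedness and
-- rearrangement all follow the descent of a key by this one recursion.
insert-ind : ∀ {n h r} (P : ℕ → State n → State n → Set) →
  (∀ {σ} → P 0 σ σ) →
  (∀ {q a e c} (lt₁ : r + suc q * h < n) (lt₀ : r + q * h < n) →
     ¬ (a (fromℕ< lt₁) Fin.< a (fromℕ< lt₀)) →
     P (suc q) (state a e c) (state a e (suc c))) →
  (∀ {q a e c τ} (lt₁ : r + suc q * h < n) (lt₀ : r + q * h < n) →
     a (fromℕ< lt₁) Fin.< a (fromℕ< lt₀) →
     P q (state (a ∘ transpose (fromℕ< lt₁) (fromℕ< lt₀)) (suc e) (suc c)) τ →
     P (suc q) (state a e c) τ) →
  ∀ q (lt : r + q * h < n) σ → P q σ (insert h r q lt σ)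
insert-ind P start stop step zero    lt σ = start
insert-ind {n} {h} {r} P start stop step (suc q) lt (state a e c)
  with lt′ ← ≤-<-trans (+-monoʳ-≤ r (m≤n+m (q * h) h)) lt
  with a (fromℕ< lt) Fin.<? a (fromℕ< lt′)
... | yes p rewrite dec-true (a (fromℕ< lt) Fin.<? a (fromℕ< lt′)) p =
  step lt lt′ p (insert-ind P start stop step q lt′ _)
... | no ¬p rewrite dec-false (a (fromℕ< lt) Fin.<? a (fromℕ< lt′)) ¬p = stop lt lt′ ¬p

-- Comparisons grow by at most `w` more than exchanges do; written without subtraction. Thus `w`
-- bounds the number of comparisons that lead to no exchange.
Cost : ∀ {n} → ℕ → State n → State n → Set
Cost w σ τ = comparisons τ + exchanges σ ≤ comparisons σ + exchanges τ + w

Cost-refl : ∀ {n} {σ : State n} → Cost 0 σ σ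
Cost-refl = m≤m+n _ 0

Cost-trans : ∀ {n v w} {ρ σ τ : State n} → Cost v ρ σ → Cost w σ τ → Cost (v + w) ρ τ
Cost-trans {v = v} {w} {ρ} {σ} {τ} p q = +-cancelʳ-≤ (comparisons σ + exchanges σ) _ _ (begin
  comparisons τ + exchanges ρ + (comparisons σ + exchanges σ)
    ≡⟨ left (comparisons τ) (exchanges ρ) (comparisons σ) (exchanges σ) ⟩
  comparisons σ + exchanges ρ + (comparisons τ + exchanges σ)
    ≤⟨ +-mono-≤ p q ⟩
  comparisons ρ + exchanges σ + v + (comparisons σ + exchanges τ + w)
    ≡⟨ right (comparisons ρ) (exchanges σ) v (comparisons σ) (exchanges τ) w ⟩
  comparisons ρ + exchanges τ + (v + w) + (comparisons σ + exchanges σ) ∎)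
  where
  open ≤-Reasoning
  left : ∀ a b c d → a + b + (c + d) ≡ c + b + (a + d)
  left = solve-∀
  right : ∀ a b c d e f → a + b + c + (d + e + f) ≡ a + e + (c + f) + (d + b)
  right = solve-∀

Cost-weaken : ∀ {n v w} {σ τ : State n} → v ≤ w → Cost v σ τ → Cost w σ τ
Cost-weaken v≤w p = ≤-trans p (+-monoʳ-≤ _ v≤w)

module _ {n h r : ℕ} where

  -- Every comparison but the last is followed by an exchange, and the last one need not exist if
  -- the key reaches the start of its chain.
  insert-cost : ∀ q (lt : r + q * h < n) σ → Cost 1 σ (insert h r q lt σ)
  insert-cost = insert-ind
    (λ _ σ τ → Cost 1 σ τ)
    (m≤m+n _ 1)
    (λ {_} {_} {e} {c} _ _ _ → ≤-reflexive (+-comm 1 (c + e)))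
    (λ {_} {_} {e} {c} {τ} _ _ _ ih → s≤s⁻¹ (≤-trans (≤-reflexive (sym (+-suc (comparisons τ) e))) ih))

  module _ {R : Rel (Fin n) 0ℓ} (R? : Decidable₂ R) (R-irrefl : Irreflexive _≡_ R) (R-trans : Transitive R)
           (h⇒R : ∀ {x y} → toℕ y ≡ toℕ x + h → R x y) where
    open Inversions R?

    -- Each exchange is paid for by an inversion that it destroys. The order `R` is left open
    -- because two orders are needed: the chain order for one pass, and the order of all positions
    -- for a whole run of passes.
    insert-inversions : ∀ q (lt : r + q * h < n) σ → let τ = insert h r q lt σ in
      exchanges τ + inversions (array τ) ≤ exchanges σ + inversions (array σ)
    insert-inversions = insert-ind
      (λ _ σ τ → exchanges τ + inversions (array τ) ≤ exchanges σ + inversions (array σ))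
      ≤-refl (λ _ _ _ → ≤-refl)
      (λ {q} {a} {e} {c} {τ} lt₁ lt₀ lt ih → ≤-trans ih
        (≤-trans (≤-reflexive (sym (+-suc e _)))
          (+-monoʳ-≤ e (exchange-inversions R-irrefl R-trans a (h⇒R (adjacent q lt₁ lt₀)) lt))))
      where
      adjacent : ∀ q (lt₁ : r + suc q * h < n) (lt₀ : r + q * h < n) →
        toℕ (fromℕ< lt₁) ≡ toℕ (fromℕ< lt₀) + h
      adjacent q lt₁ lt₀ rewrite Fin.toℕ-fromℕ< lt₁ | Fin.toℕ-fromℕ< lt₀ =
        trans (cong (r +_) (+-comm h (q * h))) (sym (+-assoc r (q * h) h))

module _ {n h : ℕ} where

  sortChain-cost : ∀ r k (σ : State n) → Cost (sum {k} (λ q → 𝟙 (r + toℕ q * h <? n))) σ (sortChain h r k σ)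
  sortChain-cost r zero    σ = Cost-refl {σ = σ}
  sortChain-cost r (suc k) σ
    rewrite sum-snoc (λ q → 𝟙 (r + q * h <? n)) k with r + k * h <? n
  ... | no  _  = Cost-weaken {σ = σ} {sortChain h r k σ} (m≤m+n _ _) (sortChain-cost r k σ)
  ... | yes lt rewrite 𝟙-yes (r + k * h <? n) lt =
    Cost-trans {ρ = σ} {sortChain h r k σ} {insert h r k lt (sortChain h r k σ)} (sortChain-cost r k σ) (insert-cost k lt (sortChain h r k σ))

  pass-cost : ∀ (σ : State n) → Cost n σ (pass h σ)
  pass-cost σ = Cost-weaken {σ = σ} {pass h σ} total≤n
    (foldl-upTo-ind
      (λ i τ → Cost (sum {i} (λ r → chain (toℕ r))) σ τ)
      (λ τ r → sortChain h r n τ) h (Cost-refl {σ = σ})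
      (λ {i} {τ} _ c → subst (λ w → Cost w σ (sortChain h i n τ)) (sym (sum-snoc chain i))
        (Cost-trans {ρ = σ} {τ} {sortChain h i n τ} c (sortChain-cost i n τ))))
    where
    chain : ℕ → ℕ
    chain r = sum {n} (λ q → 𝟙 (r + toℕ q * h <? n))

    total≤n : sum {h} (λ r → chain (toℕ r)) ≤ n
    total≤n = begin
      sum {h} (λ r → sum {n} (λ q → 𝟙 (toℕ r + toℕ q * h <? n)))
        -- With `q` outermost, the positions of one `q` form a block of `h` consecutive ones, which
        -- is the form that `sum-chains` counts.
        ≡⟨ ∑-comm {h} {n} (λ r q → 𝟙 (toℕ r + toℕ q * h <? n)) ⟩
      sum {n} (λ q → sum {h} (λ r → 𝟙 (toℕ r + toℕ q * h <? n)))
        ≡⟨ sum-cong-≗ {n} (λ q → sum-cong-≗ {h} (λ r → cong (λ m → 𝟙 (toℕ r + m <? n)) (sym (+-identityʳ _)))) ⟩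
      sum {n} (λ q → sum {h} (λ r → 𝟙 (toℕ r + (toℕ q * h + 0) <? n)))
        ≤⟨ sum-chains n h 0 n ⟩
      n ∎
      where open ≤-Reasoning

  module _ {R : Rel (Fin n) 0ℓ} (R? : Decidable₂ R) (R-irrefl : Irreflexive _≡_ R) (R-trans : Transitive R)
           (h⇒R : ∀ {x y} → toℕ y ≡ toℕ x + h → R x y) where
    open Inversions R?

    sortChain-inversions : ∀ r k σ → let τ = sortChain h r k σ in
      exchanges τ + inversions (array τ) ≤ exchanges σ + inversions (array σ)
    sortChain-inversions r zero    σ = ≤-refl
    sortChain-inversions r (suc k) σ with r + k * h <? n
    ... | no  _  = sortChain-inversions r k σ
    ... | yes lt = ≤-trans (insert-inversions {r = r} R? R-irrefl R-trans h⇒R k lt (sortChain h r k σ)) (sortChain-inversions r k σ)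

    pass-inversions : ∀ σ → let τ = pass h σ in
      exchanges τ + inversions (array τ) ≤ exchanges σ + inversions (array σ)
    pass-inversions σ = foldl-upTo-ind
      (λ _ τ → exchanges τ + inversions (array τ) ≤ exchanges σ + inversions (array σ))
      (λ τ r → sortChain h r n τ) h ≤-refl
      (λ {i} {τ} _ ih → ≤-trans (sortChain-inversions i n τ) ih)

-- Orderedness of the array after a pass

Ordered : ∀ {n} → ℕ → (Fin n → Fin n) → Set
Ordered d a = ∀ {x y} → toℕ y ≡ toℕ x + d → a x Fin.≤ a y

ordered-0 : ∀ {n} {a : Fin n → Fin n} → Ordered 0 a
ordered-0 {a = a} {x} y≡x+0 = ≤-reflexive (cong (toℕ ∘ a) (sym (Fin.toℕ-injective (trans y≡x+0 (+-identityʳ (toℕ x))))))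

ordered-+ : ∀ {n d e} {a : Fin n → Fin n} → Ordered d a → Ordered e a → Ordered (d + e) a
ordered-+ {n} {d} {e} d-ordered e-ordered {x} {y} eq = ≤-trans
  (d-ordered (Fin.toℕ-fromℕ< between))
  (e-ordered (trans eq (trans (sym (+-assoc (toℕ x) d e)) (cong (_+ e) (sym (Fin.toℕ-fromℕ< between))))))
  where
  between : toℕ x + d < n
  between = ≤-<-trans (≤-trans (+-monoʳ-≤ (toℕ x) (m≤m+n d e)) (≤-reflexive (sym eq))) (Fin.toℕ<n y)

ordered-* : ∀ {n d} {a : Fin n → Fin n} m → Ordered d a → Ordered (m * d) a
ordered-* zero    d-ordered = ordered-0
ordered-* (suc m) d-ordered = ordered-+ d-ordered (ordered-* m d-ordered)

-- Pigeonhole on an initial segment: extended by the identity above `y`, the map becomes an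
-- injective endomap of `Fin n`, and such a map cannot send everything up to `y` strictly below `y`.
no-shrinking-injection : ∀ {n} (y : Fin n) (f : Fin n → ℕ) →
  (∀ {x} → x Fin.≤ y → f x < toℕ y) →
  (∀ {x x′} → x Fin.≤ y → x′ Fin.≤ y → f x ≡ f x′ → x ≡ x′) → ⊥
no-shrinking-injection {n} y f shrinks injective =
  let z , z≤y , y≤f̂z = Fin.injective⇒existsPivot {f = f̂} f̂-injective y in pivot z≤y y≤f̂z
  where
  f<n : ∀ {x} → x Fin.≤ y → f x < n
  f<n x≤y = <-trans (shrinks x≤y) (Fin.toℕ<n y)

  f̂ : Fin n → Fin n
  f̂ x with x Fin.≤? y
  ... | yes x≤y = fromℕ< (f<n x≤y)
  ... | no  _   = x

  f̂-shrinks : ∀ {x} (x≤y : x Fin.≤ y) → fromℕ< (f<n x≤y) Fin.< y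
  f̂-shrinks x≤y = subst (_< toℕ y) (sym (Fin.toℕ-fromℕ< (f<n x≤y))) (shrinks x≤y)

  f̂-injective : ∀ {x x′} → f̂ x ≡ f̂ x′ → x ≡ x′
  f̂-injective {x} {x′} eq with x Fin.≤? y | x′ Fin.≤? y
  ... | yes x≤y | yes x′≤y = injective x≤y x′≤y (Fin.fromℕ<-injective _ _ (f<n x≤y) (f<n x′≤y) eq)
  ... | yes x≤y | no  x′≰y = contradiction (subst (Fin._≤ y) eq (<⇒≤ (f̂-shrinks x≤y))) x′≰y
  ... | no  x≰y | yes x′≤y = contradiction (subst (Fin._≤ y) (sym eq) (<⇒≤ (f̂-shrinks x′≤y))) x≰y
  ... | no  _   | no  _    = eq

  pivot : ∀ {z} → z Fin.≤ y → y Fin.≤ f̂ z → ⊥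
  pivot {z} z≤y y≤f̂z with z Fin.≤? y
  ... | yes z≤y = <⇒≱ (f̂-shrinks z≤y) y≤f̂z
  ... | no  z≰y = z≰y z≤y

-- Residues modulo the gap, the chain order, and what a pass does to chains

%-congˡ-+ : ∀ h .{{_ : NonZero h}} {a b} c → a % h ≡ b % h → (a + c) % h ≡ (b + c) % h
%-congˡ-+ h {a} {b} c eq = begin
  (a + c) % h           ≡⟨ %-distribˡ-+ a c h ⟩
  (a % h + c % h) % h   ≡⟨ cong (λ r → (r + c % h) % h) eq ⟩
  (b % h + c % h) % h   ≡⟨ %-distribˡ-+ b c h ⟨
  (b + c) % h           ∎
  where open ≡-Reasoning

%-cancelʳ-+ : ∀ h .{{_ : NonZero h}} {a b} c → (a + c) % h ≡ (b + c) % h → a % h ≡ b % h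
%-cancelʳ-+ h@(suc h-1) {a} {b} c eq =
  trans (sym (wrap a)) (trans (%-congˡ-+ h {a + c} {b + c} (c * h-1) eq) (wrap b))
  where
  -- Adding `c * (h - 1)` completes the summand `c` to the multiple `c * h`, which disappears modulo
  -- `h`; it serves as a negative of `c`.
  wrap : ∀ a → (a + c + c * h-1) % h ≡ a % h
  wrap a = trans (cong (_% h) (trans (+-assoc a c _) (cong (a +_) (sym (*-suc c h-1))))) ([m+kn]%n≡m%n a c h)

module Chains {n : ℕ} (h : ℕ) .{{_ : NonZero h}} where

  data Chain (x y : Fin n) : Set where
    chain : ∀ m → toℕ y ≡ toℕ x + suc m * h → Chain x y

  chain-< : ∀ {x y} → Chain x y → x Fin.< y
  chain-< {x} (chain m eq) = subst (toℕ x <_) (sym eq) (m<m+n (toℕ x) (<-≤-trans (>-nonZero⁻¹ h) (m≤m+n h (m * h))))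

  chain-irrefl : Irreflexive _≡_ Chain
  chain-irrefl refl c = <-irrefl refl (chain-< c)

  chain-trans : Transitive Chain
  chain-trans {x} (chain l eq) (chain m eq′) =
    chain (suc (l + m)) (trans eq′ (trans (cong (_+ suc m * h) eq) (sum-of-steps (toℕ x) l m h)))
    where
    sum-of-steps : ∀ x l m h → x + suc l * h + suc m * h ≡ x + suc (suc (l + m)) * h
    sum-of-steps = solve-∀

  adjacent : ∀ {x y} → toℕ y ≡ toℕ x + h → Chain x y
  adjacent {x} eq = chain 0 (trans eq (cong (toℕ x +_) (sym (*-identityˡ h))))

  chain? : Decidable₂ Chain
  chain? x y = map′ (λ (m , _ , eq) → chain m eq) (λ { (chain m eq) → m , bounded m eq , eq })
    (anyUpTo? (λ m → toℕ y ≟ toℕ x + suc m * h) n)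
    where
    bounded : ∀ m → toℕ y ≡ toℕ x + suc m * h → m < n
    bounded m eq = ≤-<-trans (≤-trans (n≤1+n m) (≤-trans (m≤m*n (suc m) h)
      (≤-trans (m≤n+m _ (toℕ x)) (≤-reflexive (sym eq))))) (Fin.toℕ<n y)

  chain-% : ∀ {x y} → Chain x y → toℕ x % h ≡ toℕ y % h
  chain-% {x} (chain m eq) = sym (trans (cong (_% h) eq) ([m+kn]%n≡m%n (toℕ x) (suc m) h))

  %-chain : ∀ {x y} → x Fin.< y → toℕ x % h ≡ toℕ y % h → Chain x y
  %-chain {x} {y} x<y eq = chain (toℕ y / h ∸ suc (toℕ x / h)) (begin
    toℕ y                                                                       ≡⟨ m≡m%n+[m/n]*n (toℕ y) h ⟩
    toℕ y % h + toℕ y / h * h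
      ≡⟨ cong₂ _+_ (sym eq) (cong (_* h) (sym (m∸n+n≡m quotients))) ⟩
    toℕ x % h + (toℕ y / h ∸ suc (toℕ x / h) + suc (toℕ x / h)) * h
      ≡⟨ regroup (toℕ x % h) (toℕ y / h ∸ suc (toℕ x / h)) (toℕ x / h) h ⟩
    toℕ x % h + toℕ x / h * h + suc (toℕ y / h ∸ suc (toℕ x / h)) * h
      ≡⟨ cong (_+ suc (toℕ y / h ∸ suc (toℕ x / h)) * h) (m≡m%n+[m/n]*n (toℕ x) h) ⟨
    toℕ x + suc (toℕ y / h ∸ suc (toℕ x / h)) * h                               ∎)
    where
    open ≡-Reasoning
    regroup : ∀ r d q h → r + (d + suc q) * h ≡ r + q * h + suc d * h
    regroup = solve-∀
    quotients : toℕ x / h < toℕ y / h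
    quotients = *-cancelʳ-< h _ _ (+-cancelˡ-< (toℕ x % h) _ _
      (subst₂ _<_ (m≡m%n+[m/n]*n (toℕ x) h)
        (trans (m≡m%n+[m/n]*n (toℕ y) h) (cong (_+ toℕ y / h * h) (sym eq))) x<y))

  predecessor : ∀ {x y z} → Chain x z → toℕ z ≡ toℕ y + h → x ≡ y ⊎ Chain x y
  predecessor {x} {y} {z} (chain zero eq) eq′ = inj₁ (Fin.toℕ-injective (+-cancelʳ-≡ h _ _
    (trans (cong (toℕ x +_) (sym (*-identityˡ h))) (trans (sym eq) eq′))))
  predecessor {x} {y} {z} (chain (suc m) eq) eq′ = inj₂ (chain m (+-cancelʳ-≡ h _ _
    (trans (sym eq′) (trans eq (regroup (toℕ x) m h)))))
    where
    regroup : ∀ x m h → x + suc (suc m) * h ≡ x + suc m * h + h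
    regroup = solve-∀

  successor : ∀ {x y z} → Chain x z → toℕ y ≡ toℕ x + h → z ≡ y ⊎ Chain y z
  successor {x} {y} {z} (chain zero eq) eq′ = inj₁ (Fin.toℕ-injective
    (trans eq (trans (cong (toℕ x +_) (*-identityˡ h)) (sym eq′))))
  successor {x} {y} {z} (chain (suc m) eq) eq′ = inj₂ (chain m
    (trans eq (trans (sym (+-assoc (toℕ x) h (suc m * h))) (cong (_+ suc m * h) (sym eq′)))))

  SortedOn : (Fin n → Set) → (Fin n → Fin n) → Set
  SortedOn P a = ∀ {x y} → Chain x y → P y → a x Fin.≤ a y

  module _ {r : ℕ} (r<h : r < h) (P : Fin n → Set) (P-down : ∀ {x y} → Chain x y → P y → P x) where

    -- The hypothesis excludes only pairs whose upper end is the position of the moving key. Pairs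
    -- with that position as lower end are required to be in order, so the keys already passed stay
    -- correctly above it as the excluded position moves down the chain.
    insert-sorts : ∀ q (lt : r + q * h < n) σ → P (fromℕ< lt) →
      SortedOn (λ y → P y × y ≢ fromℕ< lt) (array σ) → SortedOn P (array (insert h r q lt σ))
    insert-sorts q lt σ = insert-ind
      (λ q σ τ → ∀ {z} → toℕ z ≡ r + q * h → P z → SortedOn (λ y → P y × y ≢ z) (array σ) → SortedOn P (array τ))
      (λ {σ} → start {σ}) (λ {q} {a} {e} {c} → stop {q} {a} {e} {c}) (λ {q} {a} {e} {c} {τ} → step {q} {a} {e} {c} {τ})
      q lt σ (Fin.toℕ-fromℕ< lt)
      where
      -- A position below `h` has no predecessor on its chain, so at the start of the chain the
      -- exclusion is vacuous.
      start : ∀ {σ : State n} {z} → toℕ z ≡ r + 0 → P z → SortedOn (λ y → P y × y ≢ z) (array σ) → SortedOn P (array σ)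
      start {_} {z} z≡r Pz sorted {x} {y} (chain m eq) Py = sorted (chain m eq) (Py , λ y≡z →
        <⇒≱ r<h (≤-trans (m≤m+n h (m * h)) (≤-trans (m≤n+m _ (toℕ x))
          (≤-reflexive (trans (sym eq) (trans (cong toℕ y≡z) (trans z≡r (+-identityʳ r))))))))

      gap-apart : ∀ {q z w} → toℕ z ≡ r + suc q * h → toℕ w ≡ r + q * h → toℕ z ≡ toℕ w + h
      gap-apart {q} z≡ w≡ = trans z≡ (trans (cong (r +_) (+-comm h (q * h)))
        (trans (sym (+-assoc r (q * h) h)) (cong (_+ h) (sym w≡))))

      stop : ∀ {q a e c} (lt₁ : r + suc q * h < n) (lt₀ : r + q * h < n) →
        ¬ (a (fromℕ< lt₁) Fin.< a (fromℕ< lt₀)) →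
        ∀ {z} → toℕ z ≡ r + suc q * h → P z →
        SortedOn (λ y → P y × y ≢ z) (array (state a e c)) → SortedOn P a
      stop {q} {a} lt₁ lt₀ ¬lt {z} z≡ Pz sorted {x} {y} xRy Py with y Fin.≟ z
      ... | no  y≢z = sorted xRy (Py , y≢z)
      ... | yes refl = [ below , (λ xRw → ≤-trans (sorted xRw (P-down w→z Pz , w≢z)) w≤z) ]′ (predecessor xRy z≡w+h)
        where
        w = fromℕ< lt₀
        z≡w+h : toℕ z ≡ toℕ w + h
        z≡w+h = gap-apart {q} z≡ (Fin.toℕ-fromℕ< lt₀)
        w→z : Chain w z
        w→z = adjacent z≡w+h
        w≢z : w ≢ z
        w≢z w≡z = chain-irrefl w≡z w→z
        w≤z : a w Fin.≤ a z
        w≤z = subst (λ u → a w Fin.≤ a u) (Fin.toℕ-injective (trans (Fin.toℕ-fromℕ< lt₁) (sym z≡))) (≮⇒≥ ¬lt)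
        below : x ≡ w → a x Fin.≤ a z
        below refl = w≤z

      step : ∀ {q a e c τ} (lt₁ : r + suc q * h < n) (lt₀ : r + q * h < n) →
        a (fromℕ< lt₁) Fin.< a (fromℕ< lt₀) →
        (∀ {w} → toℕ w ≡ r + q * h → P w →
          SortedOn (λ y → P y × y ≢ w) (a ∘ transpose (fromℕ< lt₁) (fromℕ< lt₀)) → SortedOn P (array τ)) →
        ∀ {z} → toℕ z ≡ r + suc q * h → P z →
        SortedOn (λ y → P y × y ≢ z) (array (state a e c)) → SortedOn P (array τ)
      step {q} {a} {_} {_} {τ} lt₁ lt₀ lt rec {z} z≡ Pz sorted
        with refl ← Fin.toℕ-injective {i = z} {fromℕ< lt₁} (trans z≡ (sym (Fin.toℕ-fromℕ< lt₁))) =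
        rec (Fin.toℕ-fromℕ< lt₀) (P-down w→z Pz) exchanged
        where
        w = fromℕ< lt₀
        b = a ∘ transpose z w
        z≡w+h : toℕ z ≡ toℕ w + h
        z≡w+h = gap-apart {q} z≡ (Fin.toℕ-fromℕ< lt₀)
        w→z : Chain w z
        w→z = adjacent z≡w+h
        b-z : b z ≡ a w
        b-z = cong a (transpose-fst z w)
        b-w : b w ≡ a z
        b-w = cong a (transpose-snd z w)
        b-other : ∀ {x} → x ≢ z → x ≢ w → b x ≡ a x
        b-other x≢z x≢w = cong a (transpose-other z w x≢z x≢w)

        b-mono : ∀ x y {u v} → b x ≡ a u → b y ≡ a v → a u Fin.≤ a v → b x Fin.≤ b y
        b-mono _ _ bx by = subst₂ Fin._≤_ (sym bx) (sym by)

        into-z : ∀ {x} → Chain x z → x ≡ w ⊎ Chain x w → b x Fin.≤ b z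
        into-z xRz (inj₁ refl) = b-mono w z b-w b-z (<⇒≤ lt)
        into-z {x} xRz (inj₂ xRw)  = b-mono x z
          (b-other (λ x≡z → chain-irrefl x≡z xRz) (λ x≡w → chain-irrefl x≡w xRw)) b-z
          (sorted xRw (P-down w→z Pz , λ w≡z → chain-irrefl w≡z w→z))

        into-other : ∀ {x y} → Chain x y → P y → y ≢ w → y ≢ z → Dec (x ≡ z) → Dec (x ≡ w) → b x Fin.≤ b y
        into-other {x} {y} xRy Py y≢w y≢z (yes refl) _ =
          b-mono x y b-z (b-other y≢z y≢w) (sorted (chain-trans w→z xRy) (Py , y≢z))
        into-other {x} {y} xRy Py y≢w y≢z (no x≢z) (no x≢w) =
          b-mono x y (b-other x≢z x≢w) (b-other y≢z y≢w) (sorted xRy (Py , y≢z))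
        into-other {x} {y} xRy Py y≢w y≢z (no x≢z) (yes refl) with successor xRy z≡w+h
        ... | inj₁ y≡z = contradiction y≡z y≢z
        ... | inj₂ zRy = b-mono x y b-w (b-other y≢z y≢w) (sorted zRy (Py , y≢z))

        into : ∀ {x y} → Chain x y → P y → y ≢ w → Dec (y ≡ z) → b x Fin.≤ b y
        into xRy Py y≢w (yes refl) = into-z xRy (predecessor xRy z≡w+h)
        into xRy Py y≢w (no y≢z)   = into-other xRy Py y≢w y≢z (_ Fin.≟ z) (_ Fin.≟ w)

        exchanged : SortedOn (λ y → P y × y ≢ w) b
        exchanged xRy (Py , y≢w) = into xRy Py y≢w (_ Fin.≟ z)

  -- The progress of the double loop: the chains of residue below `r` are finished, and on chain `r`
  -- the first `k` elements are. It is closed downwards along chains, as `insert-sorts` demands.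
  Processed : ℕ → ℕ → Fin n → Set
  Processed r k y = toℕ y % h < r ⊎ (toℕ y % h ≡ r × toℕ y < r + k * h)

  processed-down : ∀ r k {x y} → Chain x y → Processed r k y → Processed r k x
  processed-down r k xRy (inj₁ lt)        = inj₁ (subst (_< r) (sym (chain-% xRy)) lt)
  processed-down r k xRy (inj₂ (eq , lt)) = inj₂ (trans (chain-% xRy) eq , <-trans (chain-< xRy) lt)

  processed-pred : ∀ r k {y} → Processed r (suc k) y → toℕ y ≢ r + k * h → Processed r k y
  processed-pred r k (inj₁ lt) y≢ = inj₁ lt
  processed-pred r k {y} (inj₂ (refl , lt)) y≢ = inj₂ (refl ,
    subst (_< r + k * h) (sym y≡) (+-monoʳ-< r (*-monoˡ-< h (≤∧≢⇒< (s≤s⁻¹ quotient≤) λ eq → y≢ (trans y≡ (cong (λ q → r + q * h) eq))))))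
    where
    y≡ : toℕ y ≡ toℕ y % h + toℕ y / h * h
    y≡ = m≡m%n+[m/n]*n (toℕ y) h
    quotient≤ : toℕ y / h < suc k
    quotient≤ = *-cancelʳ-< h _ _ (+-cancelˡ-< (toℕ y % h) _ _ (subst (_< r + suc k * h) y≡ lt))

  sortChain-sorts : ∀ {r} → r < h → ∀ k σ → SortedOn (Processed r 0) (array σ) →
    SortedOn (Processed r k) (array (sortChain h r k σ))
  sortChain-sorts r<h zero    σ sorted = sorted
  sortChain-sorts {r} r<h (suc k) σ sorted {x} {y} xRy Py with r + k * h <? n
  ... | no ≮n = sortChain-sorts r<h k σ sorted xRy
    (processed-pred r k Py (λ y≡ → ≮n (subst (_< n) y≡ (Fin.toℕ<n y))))
  ... | yes lt = insert-sorts r<h (Processed r (suc k)) (processed-down r (suc k)) k lt (sortChain h r k σ)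
    (inj₂ (trans (cong (_% h) (Fin.toℕ-fromℕ< lt)) (trans ([m+kn]%n≡m%n r k h) (m<n⇒m%n≡m r<h)) ,
           subst (_< r + suc k * h) (sym (Fin.toℕ-fromℕ< lt)) (+-monoʳ-< r (*-monoˡ-< h (n<1+n k)))))
    (λ xRy (Py , y≢) → sortChain-sorts r<h k σ sorted xRy
      (processed-pred r k Py (λ y≡ → y≢ (Fin.toℕ-injective (trans y≡ (sym (Fin.toℕ-fromℕ< lt)))))))
    xRy Py

  pass-sorts : ∀ σ → Ordered h (array (pass h σ))
  pass-sorts σ {x} {y} eq =
    foldl-upTo-ind (λ r τ → SortedOn (λ y → toℕ y % h < r) (array τ)) (λ τ r → sortChain h r n τ) h
      (λ _ ())
      -- When chain `r` begins, the second alternative of `Processed r 0` is empty, since a position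
      -- of residue `r` is at least `r`.
      (λ {r} {τ} r<h sorted xRy y%h<1+r → sortChain-sorts r<h n τ
        (λ { xRy (inj₁ lt) → sorted xRy lt
           ; {_} {y} xRy (inj₂ (refl , lt)) → contradiction (m%n≤m (toℕ y) h) (<⇒≱ (subst (toℕ y <_) (+-identityʳ _) lt)) })
        xRy (finished y%h<1+r))
      (adjacent eq) (m%n<n (toℕ y) h)
    where
    finished : ∀ {r y} → toℕ y % h < suc r → Processed r n y
    finished {r} {y} lt with m≤n⇒m<n∨m≡n (s≤s⁻¹ lt)
    ... | inj₁ <r = inj₁ <r
    ... | inj₂ ≡r = inj₂ (≡r , <-≤-trans (Fin.toℕ<n y) (≤-trans (m≤m*n n h) (m≤n+m _ r)))

  -- The permutation acts on positions and says where each key of `b` stood in `a`. Besides order at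
  -- distance `h`, this is all that is later used of a pass to show that it preserves other orders.
  record Rearranged (a b : Fin n → Fin n) : Set where
    constructor rearranged
    field
      π        : Permutation′ n
      reads    : ∀ x → b x ≡ a (π ⟨$⟩ʳ x)
      residues : ∀ x → toℕ (π ⟨$⟩ʳ x) % h ≡ toℕ x % h

  rearranged-refl : ∀ {a} → Rearranged a a
  rearranged-refl = rearranged Perm.id (λ _ → refl) (λ _ → refl)

  rearranged-trans : ∀ {a b c} → Rearranged a b → Rearranged b c → Rearranged a c
  rearranged-trans (rearranged π b≗ π%) (rearranged ρ c≗ ρ%) =
    rearranged (ρ ∘ₚ π) (λ x → trans (c≗ x) (b≗ _)) (λ x → trans (π% _) (ρ% x))

  rearranged-transpose : ∀ {a} i j → toℕ i % h ≡ toℕ j % h → Rearranged a (a ∘ transpose i j)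
  rearranged-transpose i j eq = rearranged (Perm.transpose i j) (λ _ → refl) residue
    where
    residue : ∀ x → toℕ (transpose i j x) % h ≡ toℕ x % h
    residue x with x Fin.≟ i
    ... | yes refl = sym eq
    ... | no _ with x Fin.≟ j
    ...   | yes refl = eq
    ...   | no _ = refl

  insert-rearranges : ∀ {r} q (lt : r + q * h < n) σ → Rearranged (array σ) (array (insert h r q lt σ))
  insert-rearranges {r} = insert-ind (λ _ σ τ → Rearranged (array σ) (array τ))
    rearranged-refl (λ _ _ _ → rearranged-refl)
    (λ {q} lt₁ lt₀ _ → rearranged-trans (rearranged-transpose _ _
      (trans (residue (suc q) lt₁) (sym (residue q lt₀)))))
    where
    residue : ∀ q (lt : r + q * h < n) → toℕ (fromℕ< lt) % h ≡ r % h
    residue q lt = trans (cong (_% h) (Fin.toℕ-fromℕ< lt)) ([m+kn]%n≡m%n r q h)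

  sortChain-rearranges : ∀ r k σ → Rearranged (array σ) (array (sortChain h r k σ))
  sortChain-rearranges r zero    σ = rearranged-refl
  sortChain-rearranges r (suc k) σ with r + k * h <? n
  ... | no  _  = sortChain-rearranges r k σ
  ... | yes lt = rearranged-trans (sortChain-rearranges r k σ) (insert-rearranges {r} k lt (sortChain h r k σ))

  pass-rearranges : ∀ σ → Rearranged (array σ) (array (pass h σ))
  pass-rearranges σ = foldl-upTo-ind (λ _ τ → Rearranged (array σ) (array τ)) (λ τ r → sortChain h r n τ) h
    rearranged-refl (λ {r} {τ} _ p → rearranged-trans p (sortChain-rearranges r n τ))

  -- If b x > b y with y = x + k, shifting by -k, re-sorting and shifting back maps
  -- the positions up to y on the chain of y that come from a position ≥ k below y;
  -- those that come from a position < k are below y anyway.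
  rearranged-ordered : ∀ {a b} k → Rearranged a b → Ordered h b → Ordered k a → Ordered k b
  rearranged-ordered {a} {b} k (rearranged π b≗ π%) h-ordered k-ordered {x} {y} y≡x+k = ≮⇒≥ λ by<bx →
    no-shrinking-injection y (λ z → proj₁ (image z)) (shrinks by<bx)
      (λ {z} {z′} _ _ eq → image-injective (proj₂ (image z)) (subst (Image z′) (sym eq) (proj₂ (image z′))))
    where
    data Image (z : Fin n) (v : ℕ) : Set where
      -- Positions of other residues are fixed, so that the map is defined on the whole initial
      -- segment. The other two cases stay in the residue class of `y` and so cannot collide with
      -- this one; they are told apart from each other by being below `k` or not.
      off  : toℕ z % h ≢ toℕ y % h → v ≡ toℕ z → Image z v
      low  : toℕ z % h ≡ toℕ y % h → v ≡ toℕ (π ⟨$⟩ʳ z) → v < k → Image z v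
      high : ∀ u → toℕ z % h ≡ toℕ y % h → toℕ (π ⟨$⟩ʳ z) ≡ toℕ u + k → v ≡ toℕ (π ⟨$⟩ˡ u) + k → Image z v

    image : ∀ z → ∃[ v ] Image z v
    image z with toℕ z % h ≟ toℕ y % h
    ... | no  differ = _ , off differ refl
    ... | yes same with toℕ (π ⟨$⟩ʳ z) <? k
    ...   | yes <k = _ , low same refl <k
    ...   | no  ≮k = _ , high (fromℕ< bound) same
      (trans (sym (m∸n+n≡m (≮⇒≥ ≮k))) (cong (_+ k) (sym (Fin.toℕ-fromℕ< bound)))) refl
      where
      bound : toℕ (π ⟨$⟩ʳ z) ∸ k < n
      bound = ≤-<-trans (m∸n≤m _ k) (Fin.toℕ<n (π ⟨$⟩ʳ z))

    π⁻¹-% : ∀ u → toℕ (π ⟨$⟩ˡ u) % h ≡ toℕ u % h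
    π⁻¹-% u = trans (sym (π% _)) (cong (λ v → toℕ v % h) (inverseʳ π))

    π-injective : ∀ {u v} → π ⟨$⟩ʳ u ≡ π ⟨$⟩ʳ v → u ≡ v
    π-injective eq = trans (sym (inverseˡ π)) (trans (cong (π ⟨$⟩ˡ_) eq) (inverseˡ π))

    on-chain : ∀ {z v} → Image z v → toℕ z % h ≡ toℕ y % h → v % h ≡ toℕ y % h
    on-chain (off differ _) same = contradiction same differ
    on-chain {z} (low same refl _) _ = trans (π% z) same
    on-chain {z} (high u same eq refl) _ =
      trans (%-congˡ-+ h k (π⁻¹-% u)) (trans (cong (_% h) (sym eq)) (trans (π% z) same))

    off-chain : ∀ {z v} → Image z v → toℕ z % h ≢ toℕ y % h → v ≡ toℕ z
    off-chain (off _ eq)        _ = eq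
    off-chain (low same _ _)    differ = contradiction same differ
    off-chain (high _ same _ _) differ = contradiction same differ

    image-injective : ∀ {z z′ v} → Image z v → Image z′ v → z ≡ z′
    image-injective {z} {z′} p p′ with toℕ z % h ≟ toℕ y % h | toℕ z′ % h ≟ toℕ y % h
    ... | no differ | no differ′ = Fin.toℕ-injective (trans (sym (off-chain p differ)) (off-chain p′ differ′))
    ... | yes same | no differ′ = contradiction (trans (cong (_% h) (sym (off-chain p′ differ′))) (on-chain p same)) differ′
    ... | no differ | yes same′ = contradiction (trans (cong (_% h) (sym (off-chain p differ))) (on-chain p′ same′)) differ
    image-injective (off differ _) _ | yes same | yes _ = contradiction same differ
    image-injective _ (off differ _) | yes _ | yes same = contradiction same differ
    image-injective (low _ eq _) (low _ eq′ _) | yes _ | yes _ =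
      π-injective (Fin.toℕ-injective (trans (sym eq) eq′))
    image-injective (low _ _ <k) (high _ _ _ refl) | yes _ | yes _ = contradiction (m≤n+m k _) (<⇒≱ <k)
    image-injective (high _ _ _ refl) (low _ _ <k) | yes _ | yes _ = contradiction (m≤n+m k _) (<⇒≱ <k)
    image-injective (high u _ eq veq) (high u′ _ eq′ veq′) | yes _ | yes _ =
      π-injective (Fin.toℕ-injective (trans eq (trans (cong (λ w → toℕ w + k) u≡u′) (sym eq′))))
      where
      u≡u′ : u ≡ u′
      u≡u′ = trans (sym (inverseʳ π)) (trans
        (cong (π ⟨$⟩ʳ_) (Fin.toℕ-injective (+-cancelʳ-≡ k _ _ (trans (sym veq) veq′)))) (inverseʳ π))

    shrinks : b y Fin.< b x → ∀ {z} → z Fin.≤ y → proj₁ (image z) < toℕ y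
    shrinks by<bx {z} z≤y with proj₂ (image z)
    ... | off differ v≡ = subst (_< toℕ y) (sym v≡) (≤∧≢⇒< z≤y (λ eq → differ (cong (_% h) eq)))
    ... | low _ _ <k = <-≤-trans <k (≤-trans (m≤n+m k (toℕ x)) (≤-reflexive (sym y≡x+k)))
    -- The key of `a` at `u` is at most `b z`, hence at most `b y`, hence less than `b x`. In `b` it
    -- stands at `t`, on the chain of `x`, so order along this chain forces `t` below `x`.
    ... | high u same πz≡ v≡ = subst₂ _<_ (sym v≡) (sym y≡x+k) (+-monoˡ-< k (≰⇒> x≰t))
      where
      t = π ⟨$⟩ˡ u
      along : ∀ {v w} → toℕ v % h ≡ toℕ w % h → v Fin.≤ w → b v Fin.≤ b w
      along {v} {w} eq v≤w with m≤n⇒m<n∨m≡n v≤w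
      ... | inj₂ v≡w = ≤-reflexive (cong (toℕ ∘ b) (Fin.toℕ-injective v≡w))
      ... | inj₁ v<w with chain m w≡ ← %-chain v<w eq = ordered-* (suc m) h-ordered w≡
      bt<bx : b t Fin.< b x
      bt<bx = begin-strict
        toℕ (b t)             ≡⟨ cong toℕ (trans (b≗ t) (cong a (inverseʳ π))) ⟩
        toℕ (a u)             ≤⟨ k-ordered πz≡ ⟩
        toℕ (a (π ⟨$⟩ʳ z))    ≡⟨ cong toℕ (b≗ z) ⟨
        toℕ (b z)             ≤⟨ along same z≤y ⟩
        toℕ (b y)             <⟨ by<bx ⟩
        toℕ (b x)             ∎
        where open ≤-Reasoning
      x≰t : ¬ (x Fin.≤ t)
      x≰t x≤t = <⇒≱ bt<bx (along (sym (trans (π⁻¹-% u) (%-cancelʳ-+ h k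
        (trans (cong (_% h) (sym πz≡)) (trans (π% z) (trans same (cong (_% h) y≡x+k))))))) x≤t)

-- The sequence of passes

representable-ordered : ∀ {n k} {a : Fin n → Fin n} (h : Vector ℕ k) {d} →
  (∀ i → Ordered (h i) a) → Representable h d → Ordered d a
representable-ordered {k = zero}  h h-ordered (x , refl) = ordered-0
representable-ordered {k = suc k} h h-ordered (x , refl) =
  ordered-+ (ordered-* (x zero) (h-ordered zero))
            (representable-ordered (h ∘ suc) (h-ordered ∘ suc) (x ∘ suc , refl))

pass-ordered : ∀ {n} h → 0 < h → ∀ k (σ : State n) →
  Ordered k (array σ) → Ordered k (array (pass h σ))
pass-ordered h h>0 k σ = rearranged-ordered k (pass-rearranges σ) (pass-sorts σ)
  where
  instance _ = >-nonZero h>0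
  open Chains h

module _ {n : ℕ} where

  chainInversions : ∀ h → 0 < h → (Fin n → Fin n) → ℕ
  chainInversions h h>0 = Inversions.inversions (Chains.chain? h {{>-nonZero h>0}})

  inversions : (Fin n → Fin n) → ℕ
  inversions = Inversions.inversions Fin._<?_

  pass-chainInversions : ∀ h h>0 σ → exchanges (pass h σ) ≤ exchanges σ + chainInversions h h>0 (array σ)
  pass-chainInversions h h>0 σ = ≤-trans (m≤m+n _ _)
    (pass-inversions chain? chain-irrefl chain-trans adjacent σ)
    where
    instance _ = >-nonZero h>0
    open Chains h

  module _ {A : Set} (gaps : A → ℕ) (gaps>0 : ∀ i → 0 < gaps i) where

    run : ∀ {k} → (Fin k → A) → State n → State n
    run e σ = foldl (λ τ j → pass (gaps j) τ) σ (List.tabulate e)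

    run-cost : ∀ {k} (e : Fin k → A) σ → Cost (k * n) σ (run e σ)
    run-cost {zero}  e σ = Cost-refl {σ = σ}
    run-cost {suc k} e σ = Cost-trans {ρ = σ} {pass (gaps (e zero)) σ} {run e σ}
      (pass-cost {h = gaps (e zero)} σ) (run-cost (e ∘ suc) (pass (gaps (e zero)) σ))

    run-inversions : ∀ {k} (e : Fin k → A) σ → let τ = run e σ in
      exchanges τ + inversions (array τ) ≤ exchanges σ + inversions (array σ)
    run-inversions {zero}  e σ = ≤-refl
    run-inversions {suc k} e σ = ≤-trans (run-inversions (e ∘ suc) (pass (gaps (e zero)) σ))
      (pass-inversions Fin._<?_ Fin.<-irrefl Fin.<-trans
        (λ {x} eq → subst (toℕ x <_) (sym eq) (m<m+n (toℕ x) (gaps>0 (e zero)))) σ)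

    -- Induction on the passes still to run. The predicate `I` accumulates order at the gaps already
    -- used: each recursive call strengthens it by one gap, and `pass-ordered` keeps it true
    -- afterwards. When `s` is used up, all remaining exchanges are charged at once to the
    -- inversions present. The bound by `F` is demanded only if a pass remains, so that `F` may be 0
    -- when `s` covers them all.
    run-exchanges : ∀ {k} (e : Fin k → A) (s : Fin (suc k)) (I : (Fin n → Fin n) → Set) (E : Vector ℕ k) (F : ℕ) →
      (∀ j σ → I (array σ) → I (array (pass (gaps j) σ))) →
      (∀ j a → I a → (∀ i → i Fin.< j → Ordered (gaps (e i)) a) → chainInversions (gaps (e j)) (gaps>0 (e j)) a ≤ E j) →
      (toℕ s < k → ∀ a → I a → (∀ i → toℕ i < toℕ s → Ordered (gaps (e i)) a) → inversions a ≤ F) →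
      ∀ σ → I (array σ) →
      exchanges (run e σ) ≤ exchanges σ + (sum (λ j → if toℕ j <ᵇ toℕ s then E j else 0) + F)
    run-exchanges {zero}  e zero I E F I-pass E-bound F-bound σ Iσ = m≤m+n _ F
    run-exchanges {suc k} e zero I E F I-pass E-bound F-bound σ Iσ = begin
      exchanges (run e σ)                                     ≤⟨ m≤m+n _ _ ⟩
      exchanges (run e σ) + inversions (array (run e σ))      ≤⟨ run-inversions e σ ⟩
      exchanges σ + inversions (array σ)                      ≤⟨ +-monoʳ-≤ _ (F-bound (s≤s z≤n) (array σ) Iσ (λ _ ())) ⟩
      exchanges σ + F                                         ≡⟨ cong (λ z → exchanges σ + (z + F)) (sum-zero (suc k)) ⟨
      exchanges σ + (sum {suc k} (λ _ → 0) + F)               ∎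
      where open ≤-Reasoning
    run-exchanges {suc k} e (suc s) I E F I-pass E-bound F-bound σ Iσ = begin
      exchanges (run (e ∘ suc) σ′)
        ≤⟨ run-exchanges (e ∘ suc) s I′ (E ∘ suc) F I′-pass E′-bound F′-bound σ′ I′σ′ ⟩
      exchanges σ′ + (rest + F)                ≤⟨ +-monoˡ-≤ _ (pass-chainInversions h (gaps>0 (e zero)) σ) ⟩
      exchanges σ + chainInversions h (gaps>0 (e zero)) (array σ) + (rest + F)
        ≤⟨ +-monoˡ-≤ _ (+-monoʳ-≤ (exchanges σ) (E-bound zero (array σ) Iσ (λ _ ()))) ⟩
      exchanges σ + E zero + (rest + F)        ≡⟨ regroup (exchanges σ) (E zero) rest F ⟩
      exchanges σ + (E zero + rest + F)        ∎
      where
      open ≤-Reasoning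
      h  = gaps (e zero)
      σ′ = pass h σ
      rest = sum (λ j → if toℕ j <ᵇ toℕ s then E (suc j) else 0)
      regroup : ∀ a b c d → a + b + (c + d) ≡ a + (b + c + d)
      regroup = solve-∀

      I′ : (Fin n → Fin n) → Set
      I′ a = I a × Ordered h a
      I′-pass : ∀ j τ → I′ (array τ) → I′ (array (pass (gaps j) τ))
      I′-pass j τ (Iτ , ordered) = I-pass j τ Iτ , λ {x} {y} → pass-ordered (gaps j) (gaps>0 j) h τ ordered
      I′σ′ : I′ (array σ′)
      I′σ′ = I-pass (e zero) σ Iσ , λ {x} {y} → Chains.pass-sorts h {{>-nonZero (gaps>0 (e zero))}} σ

      ordered-at : ∀ {t} {a} → Ordered h a →
        (∀ i → toℕ i < t → Ordered (gaps (e (suc i))) a) →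
        ∀ i → toℕ i < suc t → Ordered (gaps (e i)) a
      ordered-at ordered₀ ordered zero    _  = ordered₀
      ordered-at ordered₀ ordered (suc i) lt = ordered i (s≤s⁻¹ lt)

      E′-bound : ∀ j a → I′ a → (∀ i → i Fin.< j → Ordered (gaps (e (suc i))) a) → _
      E′-bound j a (Ia , ordered₀) ordered = E-bound (suc j) a Ia (ordered-at ordered₀ ordered)
      F′-bound : toℕ s < k → ∀ a → I′ a → (∀ i → toℕ i < toℕ s → Ordered (gaps (e (suc i))) a) → inversions a ≤ F
      F′-bound lt a (Ia , ordered₀) ordered = F-bound (s≤s lt) a Ia (ordered-at ordered₀ ordered)

-- From ordered distances to bounds on the exchanges

m<n⇒∃ : ∀ {m n} → m < n → ∃[ d ] n ≡ m + suc d
m<n⇒∃ {m} m<n with d , eq ← m≤n⇒∃[o]m+o≡n m<n = d , trans (sym eq) (sym (+-suc m d))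

distance≤ : ∀ {n d} {x y : Fin n} → toℕ y ≡ toℕ x + d → d ≤ n ∸ 1
distance≤ {suc n} {d} {x} {y} eq = ≤-trans (m≤n+m d (toℕ x)) (≤-trans (≤-reflexive (sym eq)) (s≤s⁻¹ (Fin.toℕ<n y)))

weight : ℕ → ℕ → List ℕ → ℕ
weight n h l = sumList (List.map (n ∸_) (List.map (_* h) l))

weight-∷ʳ : ∀ n h l m → weight n h (l ++ m ∷ []) ≡ weight n h l + (n ∸ m * h)
weight-∷ʳ n h []      m = +-identityʳ _
weight-∷ʳ n h (i ∷ l) m = trans (cong (n ∸ i * h +_) (weight-∷ʳ n h l m)) (sym (+-assoc (n ∸ i * h) _ _))

-- Twice the estimate of the sum of `n - m h` by `n c - h c (c + 1) / 2` for `c` multipliers, which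
-- avoids the division. It holds for increasing lists of positive integers since the i-th entry is
-- at least i; in the induction this is `length l ≤ k` when `suc k` is appended.
WeightBound : ℕ → ℕ → List ℕ → Set
WeightBound n h l = 2 * weight n h l + h * (length l * (length l + 1)) ≤ 2 * (n * length l)

weightBound-∷ʳ : ∀ n h k l → suc k * h ≤ n → length l ≤ k → WeightBound n h l → WeightBound n h (l ++ suc k ∷ [])
weightBound-∷ʳ n h k l kh≤n l≤k bound rewrite weight-∷ʳ n h l (suc k) | length-++ l {suc k ∷ []} = begin
  2 * (weight n h l + (n ∸ suc k * h)) + h * ((c + 1) * (c + 1 + 1))
    ≡⟨ split (weight n h l) (n ∸ suc k * h) h c ⟩
  2 * weight n h l + h * (c * (c + 1)) + 2 * (suc c * h + (n ∸ suc k * h))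
    ≤⟨ +-mono-≤ bound (*-monoʳ-≤ 2 (+-monoˡ-≤ _ (*-monoˡ-≤ h (s≤s l≤k)))) ⟩
  2 * (n * c) + 2 * (suc k * h + (n ∸ suc k * h))
    ≡⟨ cong (λ m → 2 * (n * c) + 2 * m) (m+[n∸m]≡n kh≤n) ⟩
  2 * (n * c) + 2 * n
    ≡⟨ join n c ⟩
  2 * (n * (c + 1)) ∎
  where
  open ≤-Reasoning
  c = length l
  split : ∀ s d h c → 2 * (s + d) + h * ((c + 1) * (c + 1 + 1)) ≡ 2 * s + h * (c * (c + 1)) + 2 * (suc c * h + d)
  split = solve-∀
  join : ∀ n c → 2 * (n * c) + 2 * n ≡ 2 * (n * (c + 1))
  join = solve-∀

weightBound-filter : ∀ {P : ℕ → Set} (P? : Decidable P) n h k → k * h ≤ n → WeightBound n h (filter P? (1⋯ k))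
weightBound-filter P? n h zero    kh≤n = ≤-reflexive (trans (*-zeroʳ h) (sym (trans (cong (2 *_) (*-zeroʳ n)) (*-zeroʳ 2))))
weightBound-filter P? n h (suc k) kh≤n =
  subst (WeightBound n h) (trans (sym (filter-++ P? (1⋯ k) (suc k ∷ []))) (cong (filter P?) (applyUpTo-∷ʳ suc k))) last
  where
  rest = filter P? (1⋯ k)
  ih : WeightBound n h rest
  ih = weightBound-filter P? n h k (≤-trans (m≤n+m (k * h) h) kh≤n)
  last : WeightBound n h (rest ++ filter P? (suc k ∷ []))
  last with does (P? (suc k))
  ... | false = subst (WeightBound n h) (sym (++-identityʳ rest)) ih
  ... | true  = weightBound-∷ʳ n h k rest kh≤n
    (≤-trans (length-filter P? (1⋯ k)) (≤-reflexive (length-applyUpTo suc k))) ih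

toℕ-inject! : ∀ {n} {s : Fin (suc n)} (i : Fin (toℕ s)) → toℕ (inject! {i = s} i) ≡ toℕ i
toℕ-inject! {suc n} {suc s} zero    = refl
toℕ-inject! {suc n} {suc s} (suc i) = cong suc (toℕ-inject! {n} {s} i)

module _ (n : ℕ) (H : GapSequence) where

  initialGaps-ordered : ∀ {a : Fin n → Fin n} (s : Fin (suc (passes H))) →
    (∀ i → toℕ i < toℕ s → Ordered (gap H i) a) → ∀ {d} → S H s d → Ordered d a
  initialGaps-ordered s ordered = representable-ordered (initialGaps H s)
    (λ i → ordered (inject! i) (subst (_< toℕ s) (sym (toℕ-inject! {s = s} i)) (Fin.toℕ<n i)))

  distances : Fin (passes H) → List ℕ
  distances j = List.map (_* gap H j) (filter (¬? ∘ Q? H j) (1⋯ M n H j))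

  passBound : Fin (passes H) → ℕ
  passBound j = sumList (List.map (n ∸_) (distances j))

  chainInversions≤passBound : ∀ j (a : Fin n → Fin n) → (∀ i → i Fin.< j → Ordered (gap H i) a) →
    chainInversions (gap H j) (positive H j) a ≤ passBound j
  chainInversions≤passBound j a ordered = inversions-≤ chain? a (distances j) covered
    where
    instance _ = >-nonZero (positive H j)
    open Chains (gap H j)
    covered : ∀ {x y} → Chain x y → a y Fin.< a x → ∃[ d ] d ∈ˡ distances j × toℕ y ≡ toℕ x + d
    covered {x} {y} (chain m eq) ay<ax = suc m * gap H j ,
      ∈-map⁺ (_* gap H j) (∈-filter⁺ (¬? ∘ Q? H j) (∈-applyUpTo⁺ suc m<M) ∉Q) , eq
      where
      ∉Q : ¬ Q H j (suc m)
      ∉Q q = <⇒≱ ay<ax (initialGaps-ordered (inject₁ j)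
        (λ i i<j → ordered i (subst (toℕ i <_) (Fin.toℕ-inject₁ j) i<j)) q eq)
      m<M : m < M n H j
      m<M = subst (_≤ M n H j) (m*n/n≡m (suc m) (gap H j)) (/-monoˡ-≤ (gap H j) (distance≤ {x = x} {y} eq))

  inversions≤U : ∀ s (a : Fin n → Fin n) → (∀ i → toℕ i < toℕ s → Ordered (gap H i) a) → inversions a ≤ U n H s
  inversions≤U s a ordered = inversions-≤ Fin._<?_ a (filter (¬? ∘ S? H s) (1⋯ (n ∸ 1))) covered
    where
    covered : ∀ {x y} → x Fin.< y → a y Fin.< a x → ∃[ d ] d ∈ˡ filter (¬? ∘ S? H s) (1⋯ (n ∸ 1)) × toℕ y ≡ toℕ x + d
    covered {x} {y} x<y ay<ax with d , eq ← m<n⇒∃ x<y = suc d ,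
      ∈-filter⁺ (¬? ∘ S? H s) (∈-applyUpTo⁺ suc (distance≤ {x = x} {y} eq)) (λ q → <⇒≱ ay<ax (initialGaps-ordered s ordered q eq)) , eq

  shellsort-exchanges : ∀ a s → exchanges (shellsort {n} H a) ≤
    sum (λ j → if toℕ j <ᵇ toℕ s then passBound j else 0) + U n H s
  shellsort-exchanges a s = run-exchanges (gap H) (positive H) id s (λ _ → ⊤) passBound (U n H s)
    _ (λ j a _ → chainInversions≤passBound j a) (λ _ a _ → inversions≤U s a) (state a 0 0) tt

  shellsort-exchanges-all : ∀ a → exchanges (shellsort {n} H a) ≤ sum passBound
  shellsort-exchanges-all a = begin
    exchanges (shellsort H a)
      -- With `s` equal to the number of passes nothing remains after it, so the tail costs 0 and no
      -- `U` appears.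
      ≤⟨ run-exchanges (gap H) (positive H) id (fromℕ (passes H)) (λ _ → ⊤) passBound 0
           _ (λ j a _ → chainInversions≤passBound j a)
           (λ p<p → contradiction p<p (<-irrefl (Fin.toℕ-fromℕ (passes H)))) (state a 0 0) tt ⟩
    sum (λ j → if toℕ j <ᵇ toℕ (fromℕ (passes H)) then passBound j else 0) + 0
      ≡⟨ +-identityʳ _ ⟩
    sum (λ j → if toℕ j <ᵇ toℕ (fromℕ (passes H)) then passBound j else 0)
      ≤⟨ sum-mono {g = passBound} (λ j → if≤ (toℕ j <ᵇ toℕ (fromℕ (passes H)))) ⟩
    sum passBound ∎
    where
    open ≤-Reasoning
    if≤ : ∀ b {m} → (if b then m else 0) ≤ m
    if≤ true  = ≤-refl
    if≤ false = z≤n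

  shellsort-comparisons : ∀ a → comparisons (shellsort {n} H a) ≤ exchanges (shellsort {n} H a) + passes H * n
  shellsort-comparisons a = subst (_≤ exchanges (shellsort H a) + passes H * n) (+-identityʳ _)
    (run-cost (gap H) (positive H) id (state a 0 0))

  passBound-≤ : ∀ j → 2 * passBound j + gap H j * (g n H j * (g n H j + 1)) ≤ 2 * (n * g n H j)
  passBound-≤ j = weightBound-filter (¬? ∘ Q? H j) n (gap H j) (M n H j) (≤-trans (m/n*n≤m (n ∸ 1) (gap H j)) (m∸n≤m n 1))
    where instance _ = >-nonZero (positive H j)

-- Naturals in ℚ and the consequences of Apéry data

-- For a variable `k` the normalised fraction does not compute. In unnormalised rationals it may be
-- replaced by the explicit fraction, where the arithmetic is that of integers.
fromℕℚ-toℚᵘ : ∀ k → toℚᵘ (fromℕℚ k) ℚᵘ.≃ mkℚᵘ (ℤ.+ k) 0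
fromℕℚ-toℚᵘ k = ℚ.toℚᵘ-fromℚᵘ (mkℚᵘ (ℤ.+ k) 0)

fromℕℚ-+ : ∀ a b → fromℕℚ (a + b) ≡ fromℕℚ a ℚ.+ fromℕℚ b
fromℕℚ-+ a b = ℚ.toℚᵘ-injective (begin-equality
  toℚᵘ (fromℕℚ (a + b))                         ≃⟨ fromℕℚ-toℚᵘ (a + b) ⟩
  mkℚᵘ (ℤ.+ (a + b)) 0
    ≃⟨ *≡* (cong₂ ℤ._*_ (cong₂ ℤ._+_ (sym (ℤ.*-identityʳ (ℤ.+ a))) (sym (ℤ.*-identityʳ (ℤ.+ b)))) refl) ⟩
  mkℚᵘ (ℤ.+ a) 0 ℚᵘ.+ mkℚᵘ (ℤ.+ b) 0            ≃⟨ ℚᵘ.+-cong (fromℕℚ-toℚᵘ a) (fromℕℚ-toℚᵘ b) ⟨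
  toℚᵘ (fromℕℚ a) ℚᵘ.+ toℚᵘ (fromℕℚ b)          ≃⟨ ℚ.toℚᵘ-homo-+ (fromℕℚ a) (fromℕℚ b) ⟨
  toℚᵘ (fromℕℚ a ℚ.+ fromℕℚ b)                  ∎)
  where open ℚᵘ.≤-Reasoning

fromℕℚ-* : ∀ a b → fromℕℚ (a * b) ≡ fromℕℚ a ℚ.* fromℕℚ b
fromℕℚ-* a b = ℚ.toℚᵘ-injective (begin-equality
  toℚᵘ (fromℕℚ (a * b))                         ≃⟨ fromℕℚ-toℚᵘ (a * b) ⟩
  mkℚᵘ (ℤ.+ (a * b)) 0                          ≃⟨ *≡* (cong₂ ℤ._*_ (ℤ.pos-* a b) refl) ⟩
  mkℚᵘ (ℤ.+ a) 0 ℚᵘ.* mkℚᵘ (ℤ.+ b) 0            ≃⟨ ℚᵘ.*-cong (fromℕℚ-toℚᵘ a) (fromℕℚ-toℚᵘ b) ⟨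
  toℚᵘ (fromℕℚ a) ℚᵘ.* toℚᵘ (fromℕℚ b)          ≃⟨ ℚ.toℚᵘ-homo-* (fromℕℚ a) (fromℕℚ b) ⟨
  toℚᵘ (fromℕℚ a ℚ.* fromℕℚ b)                  ∎)
  where open ℚᵘ.≤-Reasoning

/-* : ∀ k n .{{_ : NonZero n}} → (ℤ.+ k) ℚ./ n ℚ.* fromℕℚ n ≡ fromℕℚ k
/-* k (suc n) = ℚ.toℚᵘ-injective (begin-equality
  toℚᵘ (ℤ.+ k ℚ./ suc n ℚ.* fromℕℚ (suc n))               ≃⟨ ℚ.toℚᵘ-homo-* (ℤ.+ k ℚ./ suc n) (fromℕℚ (suc n)) ⟩
  toℚᵘ (ℤ.+ k ℚ./ suc n) ℚᵘ.* toℚᵘ (fromℕℚ (suc n))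
    ≃⟨ ℚᵘ.*-cong (ℚ.toℚᵘ-fromℚᵘ (mkℚᵘ (ℤ.+ k) n)) (fromℕℚ-toℚᵘ (suc n)) ⟩
  mkℚᵘ (ℤ.+ k) n ℚᵘ.* mkℚᵘ (ℤ.+ suc n) 0
    ≃⟨ *≡* (trans (ℤ.*-identityʳ _) (cong (ℤ.+ k ℤ.*_) (sym (ℤ.*-identityʳ _)))) ⟩
  mkℚᵘ (ℤ.+ k) 0                                          ≃⟨ fromℕℚ-toℚᵘ k ⟨
  toℚᵘ (fromℕℚ k)                                         ∎)
  where open ℚᵘ.≤-Reasoning

fromℕℚ-mono-≤ : ∀ {a b} → a ≤ b → fromℕℚ a ℚ.≤ fromℕℚ b
fromℕℚ-mono-≤ {a} {b} a≤b = ℚ.toℚᵘ-cancel-≤ (begin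
  toℚᵘ (fromℕℚ a)     ≃⟨ fromℕℚ-toℚᵘ a ⟩
  mkℚᵘ (ℤ.+ a) 0      ≤⟨ *≤* (ℤ.*-monoʳ-≤-nonNeg (ℤ.+ 1) (ℤ.+≤+ a≤b)) ⟩
  mkℚᵘ (ℤ.+ b) 0      ≃⟨ fromℕℚ-toℚᵘ b ⟨
  toℚᵘ (fromℕℚ b)     ∎)
  where open ℚᵘ.≤-Reasoning

fromℕℚ-cancel-≤ : ∀ {a b} → fromℕℚ a ℚ.≤ fromℕℚ b → a ≤ b
fromℕℚ-cancel-≤ {a} {b} ιa≤ιb = drop (begin
  mkℚᵘ (ℤ.+ a) 0      ≃⟨ fromℕℚ-toℚᵘ a ⟨
  toℚᵘ (fromℕℚ a)     ≤⟨ ℚ.toℚᵘ-mono-≤ ιa≤ιb ⟩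
  toℚᵘ (fromℕℚ b)     ≃⟨ fromℕℚ-toℚᵘ b ⟩
  mkℚᵘ (ℤ.+ b) 0      ∎)
  where
  open ℚᵘ.≤-Reasoning
  drop : mkℚᵘ (ℤ.+ a) 0 ℚᵘ.≤ mkℚᵘ (ℤ.+ b) 0 → a ≤ b
  drop (*≤* le) = ℤ.drop‿+≤+ (subst₂ ℤ._≤_ (ℤ.*-identityʳ (ℤ.+ a)) (ℤ.*-identityʳ (ℤ.+ b)) le)

0≤fromℕℚ : ∀ k → 0ℚ ℚ.≤ fromℕℚ k
0≤fromℕℚ k = fromℕℚ-mono-≤ {0} {k} z≤n

fromℕℚ-nonNeg : ∀ k → ℚ.NonNegative (fromℕℚ k)
fromℕℚ-nonNeg k = ℚ.nonNegative (0≤fromℕℚ k)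

fromℕℚ-pos : ∀ {k} → 0 < k → ℚ.Positive (fromℕℚ k)
fromℕℚ-pos {k} k>0 = ℚ.positive (ℚ.<-≤-trans (ℚ.positive⁻¹ 1ℚ) (fromℕℚ-mono-≤ k>0))

*-mono-≤ℚ : ∀ {p q r s} → 0ℚ ℚ.≤ r → 0ℚ ℚ.≤ q → p ℚ.≤ q → r ℚ.≤ s → p ℚ.* r ℚ.≤ q ℚ.* s
*-mono-≤ℚ {p} {q} {r} {s} 0≤r 0≤q p≤q r≤s = ℚ.≤-trans
  (ℚ.*-monoʳ-≤-nonNeg r {{ℚ.nonNegative 0≤r}} p≤q)
  (ℚ.*-monoˡ-≤-nonNeg q {{ℚ.nonNegative 0≤q}} r≤s)

0≤1ℚ : 0ℚ ℚ.≤ 1ℚ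
0≤1ℚ = 0≤fromℕℚ 1

sumℚ-mono : ∀ {k} {f h : Vector ℚ k} → (∀ i → f i ℚ.≤ h i) → sumℚ f ℚ.≤ sumℚ h
sumℚ-mono {zero}  f≤h = ℚ.≤-refl
sumℚ-mono {suc k} f≤h = ℚ.+-mono-≤ (f≤h zero) (sumℚ-mono (f≤h ∘ suc))

*-distribˡ-sumℚ : ∀ {k} c (f : Vector ℚ k) → c ℚ.* sumℚ f ≡ sumℚ (λ i → c ℚ.* f i)
*-distribˡ-sumℚ {zero}  c f = ℚ.*-zeroʳ c
*-distribˡ-sumℚ {suc k} c f = trans (ℚ.*-distribˡ-+ c _ _) (cong (c ℚ.* f zero ℚ.+_) (*-distribˡ-sumℚ c (f ∘ suc)))

fromℕℚ-sum : ∀ {k} (f : Vector ℕ k) → fromℕℚ (sum f) ≡ sumℚ (fromℕℚ ∘ f)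
fromℕℚ-sum {zero}  f = refl
fromℕℚ-sum {suc k} f = trans (fromℕℚ-+ (f zero) _) (cong (fromℕℚ (f zero) ℚ.+_) (fromℕℚ-sum (f ∘ suc)))

-- Representable integers and the bound from Apéry data

combination-≤ : ∀ {k} (h x : Vector ℕ k) β → (∀ i → 0 < x i → fromℕℚ (h i) ℚ.≤ β) →
  fromℕℚ (combination h x) ℚ.≤ fromℕℚ (sum x) ℚ.* β
combination-≤ {zero}  h x β h≤β = ℚ.≤-reflexive (sym (ℚ.*-zeroˡ β))
combination-≤ {suc k} h x β h≤β = begin
  fromℕℚ (x zero * h zero + combination (h ∘ suc) (x ∘ suc))
    ≡⟨ fromℕℚ-+ (x zero * h zero) _ ⟩
  fromℕℚ (x zero * h zero) ℚ.+ fromℕℚ (combination (h ∘ suc) (x ∘ suc))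
    ≤⟨ ℚ.+-mono-≤ (term (x zero) (h≤β zero)) (combination-≤ (h ∘ suc) (x ∘ suc) β (h≤β ∘ suc)) ⟩
  fromℕℚ (x zero) ℚ.* β ℚ.+ fromℕℚ (sum (x ∘ suc)) ℚ.* β
    ≡⟨ ℚ.*-distribʳ-+ β (fromℕℚ (x zero)) (fromℕℚ (sum (x ∘ suc))) ⟨
  (fromℕℚ (x zero) ℚ.+ fromℕℚ (sum (x ∘ suc))) ℚ.* β
    ≡⟨ cong (ℚ._* β) (fromℕℚ-+ (x zero) _) ⟨
  fromℕℚ (x zero + sum (x ∘ suc)) ℚ.* β ∎
  where
  open ℚ.≤-Reasoning
  term : ∀ c → (0 < c → fromℕℚ (h zero) ℚ.≤ β) → fromℕℚ (c * h zero) ℚ.≤ fromℕℚ c ℚ.* β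
  term zero      h≤β = ℚ.≤-reflexive (sym (ℚ.*-zeroˡ β))
  term c@(suc _) h≤β = ℚ.≤-trans (ℚ.≤-reflexive (fromℕℚ-* c (h zero)))
    (ℚ.*-monoˡ-≤-nonNeg (fromℕℚ c) {{fromℕℚ-nonNeg c}} (h≤β (s≤s z≤n)))

representable-+ : ∀ {k} (h : Vector ℕ k) {l m} → Representable h l → Representable h m → Representable h (l + m)
representable-+ {zero}  h (x , refl) (y , refl) = x , refl
representable-+ {suc k} h (x , refl) (y , refl)
  with z , eq ← representable-+ (h ∘ suc) (x ∘ suc , refl) (y ∘ suc , refl) =
  (x zero + y zero) Vector.∷ z , trans (cong ((x zero + y zero) * h zero +_) eq) (regroup (x zero) (y zero) (h zero) _ _)
  where
  regroup : ∀ x y h s t → (x + y) * h + (s + t) ≡ x * h + s + (y * h + t)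
  regroup = solve-∀

representable-0 : ∀ {k} (h : Vector ℕ k) → Representable h 0
representable-0 {k} h = (λ _ → 0) , sum-zero k

representable-* : ∀ {k} (h : Vector ℕ k) c {m} → Representable h m → Representable h (c * m)
representable-* h zero    r = representable-0 h
representable-* h (suc c) r = representable-+ h r (representable-* h c r)

∣-∣⇒%≡ : ∀ {a m n} .{{_ : NonZero a}} → a ∣ ∣ m - n ∣ → m % a ≡ n % a
∣-∣⇒%≡ {a} {m} {n} (divides q eq) with ≤-total m n
... | inj₁ m≤n = sym (trans (cong (_% a) (trans (sym (m+[n∸m]≡n m≤n)) (cong (m +_) (trans (sym (m≤n⇒∣m-n∣≡n∸m m≤n)) eq)))) ([m+kn]%n≡m%n m q a))
... | inj₂ n≤m = trans (cong (_% a) (trans (sym (m+[n∸m]≡n n≤m)) (cong (n +_) (trans (sym (m≤n⇒∣n-m∣≡n∸m n≤m)) eq)))) ([m+kn]%n≡m%n n q a)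

%≡⇒multiple : ∀ {a m n} .{{_ : NonZero a}} → m ≤ n → m % a ≡ n % a → ∃[ k ] n ≡ m + k * a
%≡⇒multiple {a} {m} {n} m≤n eq = n / a ∸ m / a , (begin
  n                                                 ≡⟨ m≡m%n+[m/n]*n n a ⟩
  n % a + n / a * a
    ≡⟨ cong₂ (λ r q → r + q * a) (sym eq) (sym (m+[n∸m]≡n (/-monoˡ-≤ a m≤n))) ⟩
  m % a + (m / a + (n / a ∸ m / a)) * a             ≡⟨ regroup (m % a) (m / a) (n / a ∸ m / a) a ⟩
  m % a + m / a * a + (n / a ∸ m / a) * a           ≡⟨ cong (_+ (n / a ∸ m / a) * a) (m≡m%n+[m/n]*n m a) ⟨
  m + (n / a ∸ m / a) * a                           ∎)
  where
  open ≡-Reasoning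
  regroup : ∀ r q d a → r + (q + d) * a ≡ r + q * a + d * a
  regroup = solve-∀

-- The list increases and is positive, so its last entry is at least its length. Hence a bound for
-- every single element of the complement of `Q` is already a bound for their number.
length-filter-≤-last : ∀ {P : ℕ → Set} (P? : Decidable P) k →
  length (filter P? (1⋯ k)) ≡ 0 ⊎ ∃[ m ] P m × length (filter P? (1⋯ k)) ≤ m
length-filter-≤-last P? zero = inj₁ refl
length-filter-≤-last {P} P? (suc k) =
  subst Bounded (trans (sym (filter-++ P? (1⋯ k) (suc k ∷ []))) (cong (filter P?) (applyUpTo-∷ʳ suc k))) last
  where
  Bounded : List ℕ → Set
  Bounded l = length l ≡ 0 ⊎ ∃[ m ] P m × length l ≤ m
  last : Bounded (filter P? (1⋯ k) ++ filter P? (suc k ∷ []))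
  last with P? (suc k)
  ... | no  _ = subst Bounded (sym (++-identityʳ (filter P? (1⋯ k)))) (length-filter-≤-last P? k)
  ... | yes p = inj₂ (suc k , p , (begin
    length (filter P? (1⋯ k) ++ suc k ∷ [])     ≡⟨ length-++ (filter P? (1⋯ k)) ⟩
    length (filter P? (1⋯ k)) + 1               ≡⟨ +-comm _ 1 ⟩
    suc (length (filter P? (1⋯ k)))             ≤⟨ s≤s (length-filter P? (1⋯ k)) ⟩
    suc (length (1⋯ k))                         ≡⟨ cong suc (length-applyUpTo suc k) ⟩
    suc k                                       ∎))
    where open ≤-Reasoning

module _ {H : GapSequence} {j : Fin (passes H)} {L B : ℚ} where

  -- At most `L` gaps are added, counted with multiplicity, each at most `B` times the gap of pass
  -- `j`; that gap then cancels.
  short-≤ : ∀ m → 1ℚ ℚ.≤ B → ShortRepresentation H j L B (m * gap H j) → fromℕℚ m ℚ.≤ L ℚ.* B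
  short-≤ m B≥1 short = ℚ.*-cancelʳ-≤-pos (fromℕℚ (gap H j)) {{fromℕℚ-pos (positive H j)}} (begin
    fromℕℚ m ℚ.* fromℕℚ (gap H j)                    ≡⟨ fromℕℚ-* m (gap H j) ⟨
    fromℕℚ (m * gap H j)                             ≡⟨ cong fromℕℚ represents ⟨
    fromℕℚ (combination (initialGaps H (inject₁ j)) x) ≤⟨ combination-≤ _ x (B ℚ.* fromℕℚ (gap H j)) gaps≤B*gap ⟩
    fromℕℚ (sum x) ℚ.* (B ℚ.* fromℕℚ (gap H j))      ≤⟨ ℚ.*-monoʳ-≤-nonNeg _ {{ℚ.nonNegative 0≤Bh}} norm≤L ⟩
    L ℚ.* (B ℚ.* fromℕℚ (gap H j))                   ≡⟨ ℚ.*-assoc L B _ ⟨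
    L ℚ.* B ℚ.* fromℕℚ (gap H j)                     ∎)
    where
    open ShortRepresentation short
    open ℚ.≤-Reasoning
    0≤Bh : 0ℚ ℚ.≤ B ℚ.* fromℕℚ (gap H j)
    0≤Bh = ℚ.≤-trans (ℚ.≤-reflexive (sym (ℚ.*-zeroˡ 0ℚ)))
      (*-mono-≤ℚ ℚ.≤-refl (ℚ.≤-trans 0≤1ℚ B≥1) (ℚ.≤-trans 0≤1ℚ B≥1) (0≤fromℕℚ (gap H j)))

  module _ (data′ : AperyData H j L B) where
    open AperyData data′

    0≤LB : 0ℚ ℚ.≤ L ℚ.* B
    0≤LB = ℚ.≤-trans (ℚ.≤-reflexive (sym (ℚ.*-zeroˡ 0ℚ)))
      (*-mono-≤ℚ ℚ.≤-refl (ℚ.≤-trans 0≤1ℚ L≥1) (ℚ.≤-trans 0≤1ℚ L≥1) (ℚ.≤-trans 0≤1ℚ B≥1))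

    -- An integer outside Q lies below the chosen element of Q in its residue class.
    ∉Q-≤ : ∀ m → ¬ Q H j m → fromℕℚ m ℚ.≤ L ℚ.* B
    ∉Q-≤ m m∉Q = ℚ.≤-trans (fromℕℚ-mono-≤ (≰⇒≥ λ w≤m → m∉Q (m∈Q w≤m))) (short-≤ (w r) B≥1 (w-short r r<a))
      where
      instance _ = >-nonZero (≤-trans (s≤s z≤n) a≥2)
      r = m % a
      r<a : r < a
      r<a = m%n<n m a
      gaps = initialGaps H (inject₁ j)
      m∈Q : w r ≤ m → Q H j m
      m∈Q w≤m with k , eq ← %≡⇒multiple {a} w≤m (trans (∣-∣⇒%≡ (w≡r r r<a)) (m%n%n≡m%n m a)) =
        subst (Representable gaps) (trans (regroup (w r) k a (gap H j)) (cong (_* gap H j) (sym eq)))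
          (representable-+ gaps (w∈Q r r<a) (representable-* gaps k a∈Q))
        where
        regroup : ∀ w k a h → w * h + k * (a * h) ≡ (w + k * a) * h
        regroup = solve-∀

    g≤LB : ∀ n → fromℕℚ (g n H j) ℚ.≤ L ℚ.* B
    g≤LB n = [ (λ g≡0 → subst (λ k → fromℕℚ k ℚ.≤ L ℚ.* B) (sym g≡0) 0≤LB)
             , (λ (m , m∉Q , g≤m) → ℚ.≤-trans (fromℕℚ-mono-≤ g≤m) (∉Q-≤ m m∉Q))
             ]′ (length-filter-≤-last (¬? ∘ Q? H j) (M n H j))

g≤M : ∀ n H j → g n H j ≤ M n H j
g≤M n H j = ≤-trans (length-filter (¬? ∘ Q? H j) (1⋯ M n H j)) (≤-reflexive (length-applyUpTo suc (M n H j)))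

-- The cheapest treatment of a single pass

-- Vectors are functions, and one rebuilt from head and tail agrees with the original only
-- pointwise; hence the hypothesis that `P` respects pointwise equality.
bounded-vector? : ∀ {k} N {P : Vector ℕ k → Set} → (∀ {x y} → x ≗ y → P x → P y) → Decidable P →
  Dec (∃[ x ] (∀ i → x i ≤ N) × P x)
bounded-vector? {zero}  N resp P? = map′
  (λ p → Vector.[] , (λ ()) , p) (λ (x , _ , p) → resp {x} {Vector.[]} (λ ()) p) (P? Vector.[])
bounded-vector? {suc k} N {P} resp P? = map′ to from
  (anyUpTo? (λ c → bounded-vector? {k} N {λ x → P (c Vector.∷ x)}
    (λ x≗y → resp λ { zero → refl ; (suc i) → x≗y i }) (λ x → P? (c Vector.∷ x))) (suc N))
  where
  to : (∃[ c ] c < suc N × ∃[ x ] (∀ i → x i ≤ N) × P (c Vector.∷ x)) → ∃[ x ] (∀ i → x i ≤ N) × P x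
  to (c , c<1+N , x , x≤N , p) = c Vector.∷ x , (λ { zero → s≤s⁻¹ c<1+N ; (suc i) → x≤N i }) , p
  from : (∃[ x ] (∀ i → x i ≤ N) × P x) → ∃[ c ] c < suc N × ∃[ x ] (∀ i → x i ≤ N) × P (c Vector.∷ x)
  from (x , x≤N , p) = x zero , s≤s (x≤N zero) , x ∘ suc , x≤N ∘ suc ,
    resp (λ { zero → refl ; (suc i) → refl }) p

-- Rounding down to an integer, capped at `N` so that a finite search suffices.
largest-≤ : ∀ N {q} → 0ℚ ℚ.≤ q → ∃[ l ] l ≤ N × fromℕℚ l ℚ.≤ q × (∀ m → m ≤ N → fromℕℚ m ℚ.≤ q → m ≤ l)
largest-≤ zero    0≤q = 0 , z≤n , 0≤q , λ m m≤0 _ → m≤0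
largest-≤ (suc N) {q} 0≤q with fromℕℚ (suc N) ℚ.≤? q
... | yes ≤q = suc N , ≤-refl , ≤q , λ m m≤N _ → m≤N
... | no  ≰q with l , l≤N , l≤q , greatest ← largest-≤ N 0≤q = l , m≤n⇒m≤1+n l≤N , l≤q , bound
  where
  bound : ∀ m → m ≤ suc N → fromℕℚ m ℚ.≤ q → m ≤ l
  bound m m≤1+N m≤q with m≤n⇒m<n∨m≡n m≤1+N
  ... | inj₁ m<1+N = greatest m (s≤s⁻¹ m<1+N) m≤q
  ... | inj₂ refl  = contradiction m≤q ≰q

argmax : ∀ {k} {P : Fin k → Set} (P? : Decidable P) (h : Vector ℕ k) → ∃[ i ] P i →
  ∃[ i ] P i × (∀ j → P j → h j ≤ h i)
argmax {suc k} {P} P? h (i , Pi) with Fin.any? (P? ∘ suc)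
... | no none = zero , P-zero i Pi , λ { zero _ → ≤-refl ; (suc j) Pj → contradiction (j , Pj) none }
  where
  P-zero : ∀ i → P i → P zero
  P-zero zero    Pi = Pi
  P-zero (suc i) Pi = contradiction (i , Pi) none
... | yes some with m , Pm , greatest ← argmax (P? ∘ suc) (h ∘ suc) some | P? zero
...   | no ¬P₀ = suc m , Pm , λ { zero P₀ → contradiction P₀ ¬P₀ ; (suc j) Pj → greatest j Pj }
...   | yes P₀ with ≤-total (h zero) (h (suc m))
...     | inj₁ ≤m = suc m , Pm , λ { zero _ → ≤m ; (suc j) Pj → greatest j Pj }
...     | inj₂ m≤ = zero , P₀ , λ { zero _ → ≤-refl ; (suc j) Pj → ≤-trans (greatest j Pj) m≤ }

argmin : ∀ {A : Set} (cost : A → ℚ) (a : A) {k} (f : Fin k → A) →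
  ∃[ b ] cost b ℚ.≤ cost a × (∀ i → cost b ℚ.≤ cost (f i))
argmin cost a {zero}  f = a , ℚ.≤-refl , λ ()
argmin cost a {suc k} f with b , b≤a , b≤f ← argmin cost a (f ∘ suc) | ℚ.≤-total (cost b) (cost (f zero))
... | inj₁ b≤f₀ = b , b≤a , λ { zero → b≤f₀ ; (suc i) → b≤f i }
... | inj₂ f₀≤b = f zero , ℚ.≤-trans f₀≤b b≤a , λ { zero → ℚ.≤-refl ; (suc i) → ℚ.≤-trans f₀≤b (b≤f i) }

-- The type `A` may be infinite. It has a cheapest element as soon as each element costs no less
-- than a default or than some member of a finite grid.
minimum-of-candidates : ∀ {A : Set} (cost : A → ℚ) (a : A) N {k} (f : ℕ → Fin k → A) →
  (∀ o → cost a ℚ.≤ cost o ⊎ ∃[ l ] ∃[ i ] l ≤ N × cost (f l i) ℚ.≤ cost o) →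
  ∃[ b ] ∀ o → cost b ℚ.≤ cost o
minimum-of-candidates {A} cost a N {k} f suffice = b , λ o → minimal o (suffice o)
  where
  row : ℕ → A
  row l = proj₁ (argmin cost a (f l))
  overall = argmin cost a (λ (l : Fin (suc N)) → row (toℕ l))
  b = proj₁ overall
  b≤ : ∀ l i → l ≤ N → cost b ℚ.≤ cost (f l i)
  b≤ l i l≤N = ℚ.≤-trans
    (subst (λ m → cost b ℚ.≤ cost (row m)) (Fin.toℕ-fromℕ< (s≤s l≤N)) (proj₂ (proj₂ overall) (fromℕ< (s≤s l≤N))))
    (proj₂ (proj₂ (argmin cost a (f l))) i)
  minimal : ∀ o → cost a ℚ.≤ cost o ⊎ ∃[ l ] ∃[ i ] l ≤ N × cost (f l i) ℚ.≤ cost o → cost b ℚ.≤ cost o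
  minimal o (inj₁ a≤o)                = ℚ.≤-trans (proj₁ (proj₂ overall)) a≤o
  minimal o (inj₂ (l , i , l≤N , f≤o)) = ℚ.≤-trans (b≤ l i l≤N) f≤o

module _ (n : ℕ) (H : GapSequence) (j : Fin (passes H)) where

  private
    h = gap H j
    earlier = initialGaps H (inject₁ j)
    N = M n H j
    instance _ = >-nonZero (positive H j)

  short? : ∀ L B m → Dec (ShortRepresentation H j L B m)
  short? L B m = map′
    (λ (x , _ , represents , norm , gaps) → record { x = x ; represents = represents ; norm≤L = norm ; gaps≤B*gap = gaps })
    (λ s → let open ShortRepresentation s in
       -- All gaps are positive, so no coefficient of a representation of `m` exceeds `m`.
       x , (λ i → ≤-trans (m≤m*n (x i) (earlier i) {{>-nonZero (positive H (inject! i))}})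
                   (≤-trans (term≤sum (λ i → x i * earlier i) i) (≤-reflexive represents))) ,
       represents , norm≤L , gaps≤B*gap)
    (bounded-vector? m respects λ x →
      combination earlier x ≟ m
      ×-dec fromℕℚ (sum x) ℚ.≤? L
      ×-dec Fin.all? (λ i → 0 <? x i →-dec fromℕℚ (earlier i) ℚ.≤? B ℚ.* fromℕℚ h))
    where
    Short : Vector ℕ _ → Set
    Short x = combination earlier x ≡ m × fromℕℚ (sum x) ℚ.≤ L ×
      (∀ i → 0 < x i → fromℕℚ (earlier i) ℚ.≤ B ℚ.* fromℕℚ h)
    respects : ∀ {x y} → x ≗ y → Short x → Short y
    respects x≗y (represents , norm , gaps) =
      trans (sum-cong-≗ (λ i → cong (_* earlier i) (sym (x≗y i)))) represents ,
      subst (λ s → fromℕℚ s ℚ.≤ L) (sum-cong-≗ x≗y) norm ,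
      λ i 0<y → gaps i (subst (0 <_) (sym (x≗y i)) 0<y)

  Residue : ℚ → ℚ → ℕ → ℕ → ℕ → Set
  Residue L B a r w = (r ≡ 0 → w ≡ 0) × a ∣ ∣ w - r ∣ × ShortRepresentation H j L B (w * h)

  -- A decidable form of Apéry data: `a` and the representatives are at most `N`, the function `w`
  -- becomes one existential per residue, and membership in `Q` is implied by the short
  -- representations.
  BoundedApery : ℚ → ℚ → Set
  BoundedApery L B = ∃[ a ] a < suc N × 2 ≤ a × ShortRepresentation H j L B (a * h) ×
    (∀ {r} → r < a → ∃[ w ] w < suc N × Residue L B a r w)

  abstract
    boundedApery? : ∀ L B → Dec (BoundedApery L B)
    boundedApery? L B = anyUpTo? (λ a →
      2 ≤? a ×-dec short? L B (a * h) ×-dec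
      allUpTo? (λ r → anyUpTo? (λ w →
        (r ≟ 0 →-dec w ≟ 0) ×-dec a ∣? ∣ w - r ∣ ×-dec short? L B (w * h)) (suc N)) a) (suc N)

  short⇒Q : ∀ {L B m} → ShortRepresentation H j L B (m * h) → Q H j m
  short⇒Q s = ShortRepresentation.x s , ShortRepresentation.represents s

  boundedApery⇒apery : ∀ {L B} → 1ℚ ℚ.≤ L → 1ℚ ℚ.≤ B → BoundedApery L B → AperyData H j L B
  boundedApery⇒apery {L} {B} L≥1 B≥1 (a , _ , a≥2 , a-short , residues) = record
    { L≥1 = L≥1 ; B≥1 = B≥1 ; a = a ; a≥2 = a≥2
    ; a∈Q = short⇒Q {L} {B} {a} a-short ; a-short = a-short
    ; w = w
    ; w₀≡0 = proj₁ (w-residue 0 (≤-trans (s≤s z≤n) a≥2)) refl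
    ; w∈Q = λ r r<a → short⇒Q {L} {B} {w r} (proj₂ (proj₂ (w-residue r r<a)))
    ; w≡r = λ r r<a → proj₁ (proj₂ (w-residue r r<a))
    ; w-short = λ r r<a → proj₂ (proj₂ (w-residue r r<a))
    }
    where
    w : ℕ → ℕ
    w r with r <? a
    ... | yes r<a = proj₁ (residues r<a)
    ... | no  _   = 0
    w-residue : ∀ r → r < a → Residue L B a r (w r)
    w-residue r r<a with r <? a
    ... | yes r<a′ = proj₂ (proj₂ (residues r<a′))
    ... | no  r≮a  = contradiction r<a r≮a

  -- The values to which `B` is rounded: `B` only decides which earlier gaps are allowed, so
  -- lowering it to the ratio of the largest allowed gap forbids none of them.
  ratio : Fin (toℕ (inject₁ j)) → ℚ
  ratio i = ℤ.+ earlier i ℚ./ h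

  ratio-* : ∀ i → ratio i ℚ.* fromℕℚ h ≡ fromℕℚ (earlier i)
  ratio-* i = /-* (earlier i) h

  ≤ratio : ∀ {B} i → B ℚ.* fromℕℚ h ℚ.≤ fromℕℚ (earlier i) → B ℚ.≤ ratio i
  ≤ratio i le = ℚ.*-cancelʳ-≤-pos (fromℕℚ h) {{fromℕℚ-pos (positive H j)}} (ℚ.≤-trans le (ℚ.≤-reflexive (sym (ratio-* i))))

  ratio≤ : ∀ {B} i → fromℕℚ (earlier i) ℚ.≤ B ℚ.* fromℕℚ h → ratio i ℚ.≤ B
  ratio≤ i le = ℚ.*-cancelʳ-≤-pos (fromℕℚ h) {{fromℕℚ-pos (positive H j)}} (ℚ.≤-trans (ℚ.≤-reflexive (ratio-* i)) le)

  ratio≥1 : ∀ i → 1ℚ ℚ.≤ ratio i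
  ratio≥1 i = ≤ratio i (ℚ.≤-trans (ℚ.≤-reflexive (ℚ.*-identityˡ (fromℕℚ h)))
    (fromℕℚ-mono-≤ (<⇒≤ (decreasing H earlier<j))))
    where
    earlier<j : inject! {i = inject₁ j} i Fin.< j
    earlier<j = subst₂ _<_ (sym (toℕ-inject! {s = inject₁ j} i)) (Fin.toℕ-inject₁ j) (Fin.toℕ<n i)

  -- Norms are integers, so `L` may be replaced by its integer part, and `B` by a ratio. The
  -- assumption that `L B` is at most `N` confines `L`, `a` and all representatives to the range up
  -- to `N`, which makes the search finite.
  normalise : ∀ {L B} → AperyData H j L B → L ℚ.* B ℚ.≤ fromℕℚ N →
    ∃[ l ] ∃[ i ] l ≤ N × 1 ≤ l × BoundedApery (fromℕℚ l) (ratio i) × fromℕℚ l ℚ.* ratio i ℚ.≤ L ℚ.* B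
  normalise {L} {B} d LB≤N =
    let l , l≤N , ιl≤L , greatest = largest-≤ N (ℚ.≤-trans 0≤1ℚ L≥1)
        i , i-ok , maximal = argmax (λ i → fromℕℚ (earlier i) ℚ.≤? B ℚ.* fromℕℚ h) earlier (used a-short)
        shorter : ∀ {m} → ShortRepresentation H j L B m → ShortRepresentation H j (fromℕℚ l) (ratio i) m
        shorter = shorten l i greatest maximal
    -- From `1 ≤ L ≤ N` it follows that 1 is among the integers compared with `L`, hence `1 ≤ l`.
    in l , i , l≤N , greatest 1 (fromℕℚ-cancel-≤ (ℚ.≤-trans L≥1 L≤N)) L≥1 ,
      (a , s≤s (m≤N a a-short) , a≥2 , shorter a-short ,
        λ {r} r<a → w r , s≤s (m≤N (w r) (w-short r r<a)) ,
          (λ { refl → w₀≡0 }) , w≡r r r<a , shorter (w-short r r<a)) ,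
      *-mono-≤ℚ (ℚ.≤-trans 0≤1ℚ (ratio≥1 i)) (ℚ.≤-trans 0≤1ℚ L≥1) ιl≤L (ratio≤ i i-ok)
    where
    open AperyData d
    L≤N : L ℚ.≤ fromℕℚ N
    L≤N = ℚ.≤-trans (ℚ.≤-reflexive (sym (ℚ.*-identityʳ L)))
      (ℚ.≤-trans (ℚ.*-monoˡ-≤-nonNeg L {{ℚ.nonNegative (ℚ.≤-trans 0≤1ℚ L≥1)}} B≥1) LB≤N)
    m≤N : ∀ m → ShortRepresentation H j L B (m * h) → m ≤ N
    m≤N m short = fromℕℚ-cancel-≤ (ℚ.≤-trans (short-≤ m B≥1 short) LB≤N)
    -- The positive integer `a * h` is not the empty combination, so some earlier gap occurs in it
    -- and is allowed; this starts the maximum over allowed gaps.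
    used : ShortRepresentation H j L B (a * h) → ∃[ i ] fromℕℚ (earlier i) ℚ.≤ B ℚ.* fromℕℚ h
    used s with Fin.any? (λ i → 0 <? ShortRepresentation.x s i)
    ... | yes (i , 0<x) = i , ShortRepresentation.gaps≤B*gap s i 0<x
    ... | no none = contradiction (sym (trans (sym (ShortRepresentation.represents s))
            (trans (sum-cong-≗ (λ i → cong (_* earlier i) (n≤0⇒n≡0 (≮⇒≥ λ 0<x → none (i , 0<x)))))
                   (sum-zero (toℕ (inject₁ j))))))
          (<⇒≢ (*-mono-≤ (≤-trans (s≤s z≤n) a≥2) (positive H j)))
    shorten : ∀ l i → (∀ m → m ≤ N → fromℕℚ m ℚ.≤ L → m ≤ l) →
      (∀ i′ → fromℕℚ (earlier i′) ℚ.≤ B ℚ.* fromℕℚ h → earlier i′ ≤ earlier i) →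
      ∀ {m} → ShortRepresentation H j L B m → ShortRepresentation H j (fromℕℚ l) (ratio i) m
    shorten l i greatest maximal s = record
      { x = x ; represents = represents
      ; norm≤L = fromℕℚ-mono-≤ (greatest (sum x) (fromℕℚ-cancel-≤ (ℚ.≤-trans norm≤L L≤N)) norm≤L)
      ; gaps≤B*gap = λ i′ 0<x → ℚ.≤-trans (fromℕℚ-mono-≤ (maximal i′ (gaps≤B*gap i′ 0<x)))
          (ℚ.≤-reflexive (sym (ratio-* i)))
      }
      where open ShortRepresentation s

  -- The two ways to treat a pass: `nothing` leaves it outside `J` at cost `M`, `just` puts it into
  -- `J` with the given Apéry data.
  Option : Set
  Option = Maybe (Σ[ L ∈ ℚ ] Σ[ B ∈ ℚ ] AperyData H j L B)

  optionCost : Option → ℚ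
  optionCost nothing            = fromℕℚ N
  optionCost (just (L , B , _)) = L ℚ.* B

  -- A grid point that carries no Apéry data falls back to `nothing`, which is always a legitimate
  -- option and cannot spoil the minimum.
  candidate : ∀ l i → Dec (1 ≤ l) → Dec (BoundedApery (fromℕℚ l) (ratio i)) → Option
  candidate l i (yes 1≤l) (yes b) = just (fromℕℚ l , ratio i , boundedApery⇒apery (fromℕℚ-mono-≤ 1≤l) (ratio≥1 i) b)
  candidate l i _         _       = nothing

  candidate-cost : ∀ l i 1≤l? b? {q} → 1 ≤ l → BoundedApery (fromℕℚ l) (ratio i) →
    fromℕℚ l ℚ.* ratio i ℚ.≤ q → optionCost (candidate l i 1≤l? b?) ℚ.≤ q
  candidate-cost l i (yes _)  (yes _) 1≤l b cost≤ = cost≤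
  candidate-cost l i (yes _)  (no ¬b) 1≤l b cost≤ = contradiction b ¬b
  candidate-cost l i (no 1≰l) _       1≤l b cost≤ = contradiction 1≤l 1≰l

  candidates : ℕ → Fin (toℕ (inject₁ j)) → Option
  candidates l i = candidate l i (1 ≤? l) (boundedApery? (fromℕℚ l) (ratio i))

  candidates-suffice : ∀ o → optionCost nothing ℚ.≤ optionCost o ⊎
    ∃[ l ] ∃[ i ] l ≤ N × optionCost (candidates l i) ℚ.≤ optionCost o
  candidates-suffice nothing = inj₁ ℚ.≤-refl
  candidates-suffice (just (L , B , d)) =
    [ (λ LB≤N → let l , i , l≤N , 1≤l , b , cost≤ = normalise d LB≤N in
        inj₂ (l , i , l≤N , candidate-cost l i (1 ≤? l) (boundedApery? (fromℕℚ l) (ratio i)) 1≤l b cost≤))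
    , inj₁ ]′ (ℚ.≤-total (L ℚ.* B) (fromℕℚ N))

  best-option : ∃[ o ] ∀ o′ → optionCost o ℚ.≤ optionCost o′
  best-option = minimum-of-candidates optionCost nothing N candidates candidates-suffice

-- Bounds in ℚ and the minimum over all choices

worstCase-≤ : ∀ n H cost b → (∀ a → cost (shellsort {n} H a) ≤ b) → worstCase n H cost ≤ b
worstCase-≤ n H cost b cost≤b = max≤v⁺ z≤n (All.map⁺ (All.universal (λ v → cost≤b (lookup v)) (inputs n)))

lookup-─ : ∀ {p} (I J : Subset p) j → lookup (I ─ J) j ≡ lookup I j ∧ not (lookup J j)
lookup-─ I J j = pointwise (λ _ → refl) (λ _ → refl)
  where
  -- The bitwise operation behind `_─_` is inferred by unification and described by its two defining
  -- equations alone.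
  pointwise : ∀ {f : Bool → Bool → Bool} → (∀ x → f x true ≡ false) → (∀ x → f x false ≡ x) →
    lookup (Vec.zipWith f I J) j ≡ lookup I j ∧ not (lookup J j)
  pointwise {f} f-true f-false rewrite lookup-zipWith f j I J with lookup J j
  ... | true  = trans (f-true _) (sym (∧-zeroʳ _))
  ... | false = trans (f-false _) (sym (∧-identityʳ _))

lookup-firstPasses : ∀ {p} (s : Fin (suc p)) j → lookup (firstPasses s) j ≡ (toℕ j <ᵇ toℕ s)
lookup-firstPasses s j = lookup∘tabulate (λ j → toℕ j <ᵇ toℕ s) j

if-else : ∀ b {p q} → (if b then p else 0ℚ) ℚ.+ (if not b then q else 0ℚ) ≡ (if b then p else q)
if-else true  = ℚ.+-identityʳ _
if-else false = ℚ.+-identityˡ _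

if-else-∧ : ∀ a b {p q} → (b ≡ true → a ≡ true) →
  (if b then p else 0ℚ) ℚ.+ (if a ∧ not b then q else 0ℚ) ≡ (if a then (if b then p else q) else 0ℚ)
if-else-∧ true  b     b⇒a = if-else b
if-else-∧ false false b⇒a = ℚ.+-identityˡ 0ℚ
if-else-∧ false true  b⇒a = contradiction (b⇒a refl) λ ()

if-scale : ∀ b n q {k} → fromℕℚ k ℚ.≤ n ℚ.* q → fromℕℚ (if b then k else 0) ℚ.≤ n ℚ.* (if b then q else 0ℚ)
if-scale true  n q le = le
if-scale false n q le = ℚ.≤-reflexive (sym (ℚ.*-zeroʳ n))

module Overhead (n : ℕ) (H : GapSequence) (J : Subset (passes H)) (L B : Fin (passes H) → ℚ)
                (apery : ∀ {j} → j ∈ J → AperyData H j (L j) (B j)) where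

  passCost : Fin (passes H) → ℚ
  passCost j = if lookup J j then L j ℚ.* B j else fromℕℚ (M n H j)

  g≤passCost : ∀ j → fromℕℚ (g n H j) ℚ.≤ passCost j
  g≤passCost j = by-cases (lookup J j) refl
    where
    by-cases : ∀ b → lookup J j ≡ b → fromℕℚ (g n H j) ℚ.≤ (if b then L j ℚ.* B j else fromℕℚ (M n H j))
    by-cases true  eq = g≤LB (apery (lookup⇒[]= j J eq)) n
    by-cases false _  = fromℕℚ-mono-≤ (g≤M n H j)

  sum-passCost : ∑∈ J (λ j → L j ℚ.* B j) ℚ.+ ∑∈ (∁ J) (λ j → fromℕℚ (M n H j)) ≡ sumℚ passCost
  sum-passCost = trans
    (sym (sumℚ-+ (λ j → if lookup J j then L j ℚ.* B j else 0ℚ) (λ j → if lookup (∁ J) j then fromℕℚ (M n H j) else 0ℚ)))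
    (sumℚ-cong combine)
    where
    combine : ∀ j → (if lookup J j then L j ℚ.* B j else 0ℚ) ℚ.+ (if lookup (∁ J) j then fromℕℚ (M n H j) else 0ℚ) ≡ passCost j
    combine j = trans
      (cong (λ b → (if lookup J j then L j ℚ.* B j else 0ℚ) ℚ.+ (if b then fromℕℚ (M n H j) else 0ℚ)) (lookup-map j not J))
      (if-else (lookup J j))

  overhead-≥ : fromℕℚ (passes H + sum (g n H)) ℚ.≤ overhead n H J L B
  overhead-≥ = begin
    fromℕℚ (passes H + sum (g n H))                       ≡⟨ fromℕℚ-+ (passes H) (sum (g n H)) ⟩
    fromℕℚ (passes H) ℚ.+ fromℕℚ (sum (g n H))            ≡⟨ cong (fromℕℚ (passes H) ℚ.+_) (fromℕℚ-sum (g n H)) ⟩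
    fromℕℚ (passes H) ℚ.+ sumℚ (fromℕℚ ∘ g n H)           ≤⟨ ℚ.+-monoʳ-≤ (fromℕℚ (passes H)) (sumℚ-mono g≤passCost) ⟩
    fromℕℚ (passes H) ℚ.+ sumℚ passCost                   ≡⟨ cong (fromℕℚ (passes H) ℚ.+_) sum-passCost ⟨
    fromℕℚ (passes H) ℚ.+ (∑∈ J (λ j → L j ℚ.* B j) ℚ.+ ∑∈ (∁ J) (λ j → fromℕℚ (M n H j)))
      ≡⟨ ℚ.+-assoc (fromℕℚ (passes H)) _ _ ⟨
    overhead n H J L B                                    ∎
    where open ℚ.≤-Reasoning

module _ (n : ℕ) (H : GapSequence) where

  totalSaving : ℕ
  totalSaving = sum (λ j → gap H j * (g n H j * (g n H j + 1)))

  -- One number for both measures: it bounds the comparisons, and a fortiori the exchanges.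
  totalBound : ℕ
  totalBound = sum (passBound n H) + passes H * n

  exchanges≤totalBound : ∀ a → exchanges (shellsort {n} H a) ≤ totalBound
  exchanges≤totalBound a = ≤-trans (shellsort-exchanges-all n H a) (m≤m+n _ _)

  comparisons≤totalBound : ∀ a → comparisons (shellsort {n} H a) ≤ totalBound
  comparisons≤totalBound a = ≤-trans (shellsort-comparisons n H a) (+-monoˡ-≤ _ (shellsort-exchanges-all n H a))

  2*totalBound+saving≤ : 2 * totalBound + totalSaving ≤ 2 * (n * (passes H + sum (g n H)))
  2*totalBound+saving≤ = begin
    2 * (sum (passBound n H) + passes H * n) + totalSaving
      ≡⟨ regroup (sum (passBound n H)) (passes H) n totalSaving ⟩
    2 * sum (passBound n H) + totalSaving + 2 * (n * passes H)
      ≡⟨ cong (λ z → z + totalSaving + 2 * (n * passes H)) (*-distribˡ-sum 2 (passBound n H)) ⟩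
    sum (λ j → 2 * passBound n H j) + totalSaving + 2 * (n * passes H)
      ≡⟨ cong (_+ 2 * (n * passes H)) (∑-distrib-+ (λ j → 2 * passBound n H j) (λ j → gap H j * (g n H j * (g n H j + 1)))) ⟨
    sum (λ j → 2 * passBound n H j + gap H j * (g n H j * (g n H j + 1))) + 2 * (n * passes H)
      ≤⟨ +-monoˡ-≤ _ (sum-mono {g = λ j → 2 * (n * g n H j)} (passBound-≤ n H)) ⟩
    sum (λ j → 2 * (n * g n H j)) + 2 * (n * passes H)
      ≡⟨ cong (_+ 2 * (n * passes H)) (trans (cong (2 *_) (*-distribˡ-sum n (g n H))) (*-distribˡ-sum 2 (λ j → n * g n H j))) ⟨
    2 * (n * sum (g n H)) + 2 * (n * passes H)
      ≡⟨ join n (passes H) (sum (g n H)) ⟩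
    2 * (n * (passes H + sum (g n H))) ∎
    where
    open ≤-Reasoning
    regroup : ∀ e p n s → 2 * (e + p * n) + s ≡ 2 * e + s + 2 * (n * p)
    regroup = solve-∀
    join : ∀ n p g → 2 * (n * g) + 2 * (n * p) ≡ 2 * (n * (p + g))
    join = solve-∀

  totalBound+½saving≤ : fromℕℚ totalBound ℚ.+ ½ ℚ.* fromℕℚ totalSaving ℚ.≤ fromℕℚ n ℚ.* fromℕℚ (passes H + sum (g n H))
  totalBound+½saving≤ = begin
    fromℕℚ totalBound ℚ.+ ½ ℚ.* fromℕℚ totalSaving
      ≡⟨ halve (fromℕℚ totalBound) (fromℕℚ totalSaving) ⟩
    ½ ℚ.* (fromℕℚ 2 ℚ.* fromℕℚ totalBound ℚ.+ fromℕℚ totalSaving)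
      ≡⟨ cong (½ ℚ.*_) (trans (fromℕℚ-+ (2 * totalBound) totalSaving) (cong (ℚ._+ fromℕℚ totalSaving) (fromℕℚ-* 2 totalBound))) ⟨
    ½ ℚ.* fromℕℚ (2 * totalBound + totalSaving)
      ≤⟨ ℚ.*-monoˡ-≤-nonNeg ½ (fromℕℚ-mono-≤ 2*totalBound+saving≤) ⟩
    ½ ℚ.* fromℕℚ (2 * (n * G))
      ≡⟨ cong (½ ℚ.*_) (trans (fromℕℚ-* 2 (n * G)) (cong (fromℕℚ 2 ℚ.*_) (fromℕℚ-* n G))) ⟩
    ½ ℚ.* (fromℕℚ 2 ℚ.* (fromℕℚ n ℚ.* fromℕℚ G))
      ≡⟨ halve′ (fromℕℚ n ℚ.* fromℕℚ G) ⟩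
    fromℕℚ n ℚ.* fromℕℚ G ∎
    where
    open ℚ.≤-Reasoning
    G = passes H + sum (g n H)
    halve′ : ∀ x → ½ ℚ.* (fromℕℚ 2 ℚ.* x) ≡ x
    halve′ x = trans (sym (ℚ.*-assoc ½ (fromℕℚ 2) x)) (ℚ.*-identityˡ x)
    halve : ∀ x s → x ℚ.+ ½ ℚ.* s ≡ ½ ℚ.* (fromℕℚ 2 ℚ.* x ℚ.+ s)
    halve x s = sym (trans (ℚ.*-distribˡ-+ ½ (fromℕℚ 2 ℚ.* x) s) (cong (ℚ._+ ½ ℚ.* s) (halve′ x)))

module _ (n : ℕ) (H : GapSequence) (J : Subset (passes H)) (L B : Fin (passes H) → ℚ)
         (apery : ∀ {j} → j ∈ J → AperyData H j (L j) (B j)) where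
  open Overhead n H J L B apery

  private
    bound = fromℕℚ n ℚ.* overhead n H J L B
    half  = ½ ℚ.* fromℕℚ (totalSaving n H)

    0≤half : 0ℚ ℚ.≤ half
    0≤half = ℚ.≤-trans (ℚ.≤-reflexive (sym (ℚ.*-zeroʳ ½))) (ℚ.*-monoˡ-≤-nonNeg ½ (0≤fromℕℚ (totalSaving n H)))

  bound-half≤bound : bound ℚ.- half ℚ.≤ bound
  bound-half≤bound = ℚ.≤-trans (ℚ.+-monoʳ-≤ bound (ℚ.neg-antimono-≤ 0≤half)) (ℚ.≤-reflexive (ℚ.+-identityʳ bound))

  -- Apéry data enlarge only the linear term, where `g` is replaced by `L B` or `M`; the saving
  -- keeps the exact values of `g`. It must therefore be subtracted after, and not before, the
  -- passage to `overhead`.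
  totalBound≤ : fromℕℚ (totalBound n H) ℚ.≤ bound ℚ.- half
  totalBound≤ = begin
    fromℕℚ (totalBound n H)                                  ≡⟨ ℚ.+-identityʳ _ ⟨
    fromℕℚ (totalBound n H) ℚ.+ 0ℚ
      ≡⟨ cong (fromℕℚ (totalBound n H) ℚ.+_) (ℚ.+-inverseʳ half) ⟨
    fromℕℚ (totalBound n H) ℚ.+ (half ℚ.- half)              ≡⟨ ℚ.+-assoc (fromℕℚ (totalBound n H)) half (ℚ.- half) ⟨
    fromℕℚ (totalBound n H) ℚ.+ half ℚ.- half                ≤⟨ ℚ.+-monoˡ-≤ (ℚ.- half) (totalBound+½saving≤ n H) ⟩
    fromℕℚ n ℚ.* fromℕℚ (passes H + sum (g n H)) ℚ.- half
      ≤⟨ ℚ.+-monoˡ-≤ (ℚ.- half) (ℚ.*-monoˡ-≤-nonNeg (fromℕℚ n) {{fromℕℚ-nonNeg n}} overhead-≥) ⟩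
    bound ℚ.- half                                           ∎
    where open ℚ.≤-Reasoning

  C≤bound-half : fromℕℚ (C n H) ℚ.≤ bound ℚ.- half
  C≤bound-half = ℚ.≤-trans (fromℕℚ-mono-≤ (worstCase-≤ n H comparisons (totalBound n H) (comparisons≤totalBound n H))) totalBound≤

  W≤bound : fromℕℚ (W n H) ℚ.≤ bound
  W≤bound = ℚ.≤-trans (fromℕℚ-mono-≤ (worstCase-≤ n H exchanges (totalBound n H) (exchanges≤totalBound n H)))
    (ℚ.≤-trans totalBound≤ bound-half≤bound)

  C≤bound : fromℕℚ (C n H) ℚ.≤ bound
  C≤bound = ℚ.≤-trans C≤bound-half bound-half≤bound

-- Arbitrary choices of `s` and `J`, and the minimum

module _ (n : ℕ) .{{_ : NonTrivial n}} (H : GapSequence) where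
  private
    instance
      n≢0 : NonZero n
      n≢0 = nonTrivial⇒nonZero n

  choiceCost : (c : Choice H) → Fin (passes H) → ℚ
  choiceCost c j = if toℕ j <ᵇ toℕ s then (if lookup J j then L j ℚ.* B j else fromℕℚ (M n H j)) else 0ℚ
    where open Choice c

  -- Since `J` lies within the first `s` passes, the two sums merge into one cost per pass, which
  -- can then be minimised pass by pass.
  value-split : ∀ c → value n H c ≡ sumℚ (choiceCost c) ℚ.+ (ℤ.+ U n H (Choice.s c)) ℚ./ n
  value-split c = cong (ℚ._+ (ℤ.+ U n H s) ℚ./ n) (trans
    (sym (sumℚ-+ (λ j → if lookup J j then L j ℚ.* B j else 0ℚ) (λ j → if lookup (firstPasses s ─ J) j then fromℕℚ (M n H j) else 0ℚ)))
    (sumℚ-cong combine))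
    where
    open Choice c
    J-early : ∀ j → lookup J j ≡ true → (toℕ j <ᵇ toℕ s) ≡ true
    J-early j eq = trans (sym (lookup-firstPasses s j)) ([]=⇒lookup (J⊆s (lookup⇒[]= j J eq)))
    combine : ∀ j → (if lookup J j then L j ℚ.* B j else 0ℚ) ℚ.+ (if lookup (firstPasses s ─ J) j then fromℕℚ (M n H j) else 0ℚ)
            ≡ choiceCost c j
    combine j = trans
      (cong (λ b → (if lookup J j then L j ℚ.* B j else 0ℚ) ℚ.+ (if b then fromℕℚ (M n H j) else 0ℚ))
        (trans (lookup-─ (firstPasses s) J j) (cong (_∧ not (lookup J j)) (lookup-firstPasses s j))))
      (if-else-∧ (toℕ j <ᵇ toℕ s) (lookup J j) (J-early j))

  choiceBound : Choice H → ℕ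
  choiceBound c = sum (λ j → if toℕ j <ᵇ toℕ s then passBound n H j else 0) + U n H s
    where open Choice c

  passBound≤n*g : ∀ j → passBound n H j ≤ n * g n H j
  passBound≤n*g j = *-cancelˡ-≤ 2 (≤-trans (m≤m+n _ _) (passBound-≤ n H j))

  choiceBound≤ : ∀ c → fromℕℚ (choiceBound c) ℚ.≤ fromℕℚ n ℚ.* value n H c
  choiceBound≤ c = begin
    fromℕℚ (choiceBound c)
      ≡⟨ fromℕℚ-+ (sum early) (U n H s) ⟩
    fromℕℚ (sum early) ℚ.+ fromℕℚ (U n H s)
      ≡⟨ cong₂ ℚ._+_ (fromℕℚ-sum early) (sym (trans (ℚ.*-comm (fromℕℚ n) (ℤ.+ U n H s ℚ./ n)) (/-* (U n H s) n))) ⟩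
    sumℚ (fromℕℚ ∘ early) ℚ.+ fromℕℚ n ℚ.* (ℤ.+ U n H s ℚ./ n)
      ≤⟨ ℚ.+-monoˡ-≤ _ (sumℚ-mono term) ⟩
    sumℚ (λ j → fromℕℚ n ℚ.* choiceCost c j) ℚ.+ fromℕℚ n ℚ.* (ℤ.+ U n H s ℚ./ n)
      ≡⟨ cong (ℚ._+ fromℕℚ n ℚ.* (ℤ.+ U n H s ℚ./ n)) (*-distribˡ-sumℚ (fromℕℚ n) (choiceCost c)) ⟨
    fromℕℚ n ℚ.* sumℚ (choiceCost c) ℚ.+ fromℕℚ n ℚ.* (ℤ.+ U n H s ℚ./ n)
      ≡⟨ ℚ.*-distribˡ-+ (fromℕℚ n) _ _ ⟨
    fromℕℚ n ℚ.* (sumℚ (choiceCost c) ℚ.+ ℤ.+ U n H s ℚ./ n)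
      ≡⟨ cong (fromℕℚ n ℚ.*_) (value-split c) ⟨
    fromℕℚ n ℚ.* value n H c ∎
    where
    open Choice c
    open Overhead n H J L B apery
    open ℚ.≤-Reasoning
    early : Fin (passes H) → ℕ
    early j = if toℕ j <ᵇ toℕ s then passBound n H j else 0
    term : ∀ j → fromℕℚ (early j) ℚ.≤ fromℕℚ n ℚ.* choiceCost c j
    term j = if-scale (toℕ j <ᵇ toℕ s) (fromℕℚ n) (passCost j) (begin
      fromℕℚ (passBound n H j)             ≤⟨ fromℕℚ-mono-≤ (passBound≤n*g j) ⟩
      fromℕℚ (n * g n H j)                 ≡⟨ fromℕℚ-* n (g n H j) ⟩
      fromℕℚ n ℚ.* fromℕℚ (g n H j)        ≤⟨ ℚ.*-monoˡ-≤-nonNeg (fromℕℚ n) {{fromℕℚ-nonNeg n}} (g≤passCost j) ⟩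
      fromℕℚ n ℚ.* passCost j              ∎)

  W≤value : ∀ c → fromℕℚ (W n H) ℚ.≤ fromℕℚ n ℚ.* value n H c
  W≤value c = ℚ.≤-trans
    (fromℕℚ-mono-≤ (worstCase-≤ n H exchanges (choiceBound c) (λ a → shellsort-exchanges n H a (Choice.s c))))
    (choiceBound≤ c)

  C≤value : ∀ c → fromℕℚ (C n H) ℚ.≤ fromℕℚ n ℚ.* (fromℕℚ (passes H) ℚ.+ value n H c)
  C≤value c = begin
    fromℕℚ (C n H)
      ≤⟨ fromℕℚ-mono-≤ (worstCase-≤ n H comparisons (choiceBound c + passes H * n) (λ a →
           ≤-trans (shellsort-comparisons n H a) (+-monoˡ-≤ _ (shellsort-exchanges n H a (Choice.s c))))) ⟩
    fromℕℚ (choiceBound c + passes H * n)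
      ≡⟨ trans (fromℕℚ-+ (choiceBound c) (passes H * n)) (ℚ.+-comm (fromℕℚ (choiceBound c)) _) ⟩
    fromℕℚ (passes H * n) ℚ.+ fromℕℚ (choiceBound c)
      ≤⟨ ℚ.+-monoʳ-≤ (fromℕℚ (passes H * n)) (choiceBound≤ c) ⟩
    fromℕℚ (passes H * n) ℚ.+ fromℕℚ n ℚ.* value n H c
      ≡⟨ cong (ℚ._+ fromℕℚ n ℚ.* value n H c) (trans (cong fromℕℚ (*-comm (passes H) n)) (fromℕℚ-* n (passes H))) ⟩
    fromℕℚ n ℚ.* fromℕℚ (passes H) ℚ.+ fromℕℚ n ℚ.* value n H c
      ≡⟨ ℚ.*-distribˡ-+ (fromℕℚ n) _ _ ⟨
    fromℕℚ n ℚ.* (fromℕℚ (passes H) ℚ.+ value n H c) ∎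
    where open ℚ.≤-Reasoning

  module _ (best : ∀ j → ∃[ o ] ∀ o′ → optionCost n H j o ℚ.≤ optionCost n H j o′) where

    option : ∀ j → Option n H j
    option j = proj₁ (best j)

    optionL optionB : ∀ {j} → Option n H j → ℚ
    -- Placeholders: a pass with option `nothing` is kept out of `bestJ`, so these values never
    -- enter the cost.
    optionL nothing            = 1ℚ
    optionL (just (L , _ , _)) = L
    optionB nothing            = 1ℚ
    optionB (just (_ , B , _)) = B

    option-apery : ∀ {j} (o : Option n H j) → is-just o ≡ true → AperyData H j (optionL o) (optionB o)
    option-apery (just (_ , _ , d)) _ = d

    bestJ : Fin (suc (passes H)) → Subset (passes H)
    bestJ s = Vec.tabulate (λ j → (toℕ j <ᵇ toℕ s) ∧ is-just (option j))

    lookup-bestJ : ∀ s j → lookup (bestJ s) j ≡ (toℕ j <ᵇ toℕ s) ∧ is-just (option j)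
    lookup-bestJ s j = lookup∘tabulate (λ j → (toℕ j <ᵇ toℕ s) ∧ is-just (option j)) j

    ∈bestJ : ∀ s {j} → j ∈ bestJ s → (toℕ j <ᵇ toℕ s) ≡ true × is-just (option j) ≡ true
    ∈bestJ s {j} j∈J = split _ _ (trans (sym (lookup-bestJ s j)) ([]=⇒lookup j∈J))
      where
      split : ∀ a b → a ∧ b ≡ true → a ≡ true × b ≡ true
      split true true refl = refl , refl

    bestChoice : Fin (suc (passes H)) → Choice H
    bestChoice s = record
      { s = s
      ; J = bestJ s
      ; J⊆s = λ {j} j∈J → lookup⇒[]= j (firstPasses s) (trans (lookup-firstPasses s j) (proj₁ (∈bestJ s j∈J)))
      ; L = λ j → optionL (option j)
      ; B = λ j → optionB (option j)
      ; apery = λ {j} j∈J → option-apery (option j) (proj₂ (∈bestJ s j∈J))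
      }

    bestCost≤ : ∀ c j → choiceCost (bestChoice (Choice.s c)) j ℚ.≤ choiceCost c j
    bestCost≤ c j = early (toℕ j <ᵇ toℕ s) refl
      where
      open Choice c
      pay : Bool → ℚ
      pay b = if b then optionL (option j) ℚ.* optionB (option j) else fromℕℚ (M n H j)
      cost : ∀ o → (if is-just o then optionL o ℚ.* optionB o else fromℕℚ (M n H j)) ≡ optionCost n H j o
      cost nothing  = refl
      cost (just _) = refl
      optimal : ∀ b → lookup J j ≡ b → optionCost n H j (option j) ℚ.≤ (if b then L j ℚ.* B j else fromℕℚ (M n H j))
      optimal true  eq = proj₂ (best j) (just (L j , B j , apery (lookup⇒[]= j J eq)))
      optimal false _  = proj₂ (best j) nothing
      early : ∀ b → (toℕ j <ᵇ toℕ s) ≡ b →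
        (if b then pay (lookup (bestJ s) j) else 0ℚ) ℚ.≤ (if b then (if lookup J j then L j ℚ.* B j else fromℕℚ (M n H j)) else 0ℚ)
      early false eq = ℚ.≤-refl
      early true  eq = ℚ.≤-trans
        (ℚ.≤-reflexive (trans (cong pay (trans (lookup-bestJ s j) (cong (_∧ is-just (option j)) eq))) (cost (option j))))
        (optimal (lookup J j) refl)

    bestChoice≤ : ∀ c → value n H (bestChoice (Choice.s c)) ℚ.≤ value n H c
    bestChoice≤ c = subst₂ ℚ._≤_ (sym (value-split (bestChoice (Choice.s c)))) (sym (value-split c))
      (ℚ.+-monoˡ-≤ (ℤ.+ U n H (Choice.s c) ℚ./ n) (sumℚ-mono (bestCost≤ c)))

    -- For fixed `s` the cheapest option in every pass gives the cheapest choice, because the pass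
    -- costs are independent and `U` depends on `s` alone. What remains is a minimum over the
    -- finitely many `s`.
    minimal-choice : ∃[ c ] ∀ c′ → value n H c ℚ.≤ value n H c′
    minimal-choice =
      let s , _ , s≤ = argmin (λ s → value n H (bestChoice s)) zero id
      in bestChoice s , λ c′ → ℚ.≤-trans (s≤ (Choice.s c′)) (bestChoice≤ c′)

  𝔄-bounds : (∃[ c ] ∀ c′ → value n H c ℚ.≤ value n H c′) →
    ∃[ α ] Is𝔄 n H α × (fromℕℚ (W n H) ℚ.≤ fromℕℚ n ℚ.* α)
                     × (fromℕℚ (C n H) ℚ.≤ fromℕℚ n ℚ.* (fromℕℚ (passes H) ℚ.+ α))
  𝔄-bounds (c , minimal) = value n H c , ((c , refl) , minimal) , W≤value c , C≤value c

corollaryE8 :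
  (∀ (n : ℕ) .{{_ : NonTrivial n}} (H : GapSequence) (J : Subset (passes H)) (L B : Fin (passes H) → ℚ)
     → zero ∉ J
     → (∀ {j} → j ∈ J → AperyData H j (L j) (B j))
     → let bound  = fromℕℚ n ℚ.* overhead n H J L B
           saving = ½ ℚ.* fromℕℚ (sum (λ j → gap H j * (g n H j * (g n H j + 1))))
       in (fromℕℚ (C n H) ℚ.≤ bound ℚ.- saving) × (bound ℚ.- saving ℚ.≤ bound))
  × (∀ (H : ℕ → GapSequence) (J : ∀ n → Subset (passes (H n))) (L B : ∀ n → Fin (passes (H n)) → ℚ)
     → (∀ n → 2 ≤ n → zero ∉ J n)
     → (∀ n → 2 ≤ n → ∀ {j} → j ∈ J n → AperyData (H n) j (L n j) (B n j))
     → Polylogarithmic (λ n → overhead n (H n) (J n) (L n) (B n))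
     → QuasiLinear (λ n → W n (H n)) × QuasiLinear (λ n → C n (H n)))
  × (∀ (n : ℕ) .{{_ : NonTrivial n}} (H : GapSequence)
     → ∃[ α ] Is𝔄 n H α
              × (fromℕℚ (W n H) ℚ.≤ fromℕℚ n ℚ.* α)
              × (fromℕℚ (C n H) ℚ.≤ fromℕℚ n ℚ.* (fromℕℚ (passes H) ℚ.+ α)))
corollaryE8 =
    (λ n H J L B _ apery → C≤bound-half n H J L B apery , bound-half≤bound n H J L B apery)
  -- For exchanges and comparisons alike the polylogarithmic factor is the overhead itself.
  , (λ H J L B _ apery polylog →
        (_ , polylog , λ n 2≤n → W≤bound n (H n) (J n) (L n) (B n) (apery n 2≤n))
      , (_ , polylog , λ n 2≤n → C≤bound n (H n) (J n) (L n) (B n) (apery n 2≤n)))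
  , (λ n H → 𝔄-bounds n H (minimal-choice n H (best-option n H)))
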